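{- Let $B_n(t)=\sum_{k=0}^{n}\binom{n}{k}^2t^k$ for $n\ge0$ and $B_n(t)=0$ for $n<0$, and let $D_m(B(t);n)=\det(B_{i+j+m}(t))_{i,j=0}^{n-1}$. Then for every integer $m\ge1$: $D_{ -m}(B(t);n)=0$ for $1\le n\le m$, and for $n\ge m+1$ $$D_{ -m}(B(t);n)=(-1)^{\binom{m+1}{2}}\,(2t)^{\,n-m-1}\,p_{m+1}(t,n-m-1)$$ as an identity of polynomials in $t$.
   Context: The Narayana polynomials are $C_0(t)=1$ and $C_n(t)=\sum_{k=0}^{n-1}\binom{n-1}{k}\binom{n}{k}\frac{1}{k+1}t^k$ for $n\ge1$, extended by $C_n(t)=0$ for $n<0$. For integers $m,n\ge0$, $p_m(t,n)=\det(C_{i+j+m}(t))_{i,j=0}^{n-1}$ (the $0\times0$ determinant being $1$). It is known that $\sum_{n\ge0}B_n(t)x^n=\frac{1}{\sqrt{(1-(1+t)x)^2-4tx^2}}$. -}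

module Defs where

open import Algebra.Bundles.Raw using (RawRing)
import Algebra.Definitions.RawSemiring as RawSemiringDefs
open import Data.Fin.Base using (Fin; zero; suc; toℕ; punchIn)
open import Data.Integer.Base as ℤ using (ℤ; +_; -[1+_])
open import Data.List.Base using (List; []; _∷_; map; applyUpTo)
open import Data.Nat.Base as ℕ using (ℕ; zero; suc)
open import Data.Nat.Combinatorics using (_C_)
open import Data.Rational.Base as ℚ using (ℚ; 0ℚ; 1ℚ; _/_)
open import Level using (0ℓ)
open import Relation.Binary.PropositionalEquality.Core using (_≡_)

------------------------------------------------------------------------
-- Determinants

module Determinant {c ℓ} (R : RawRing c ℓ) where

  open RawRing R
  open RawSemiringDefs rawSemiring using (_^_; sum)

  -- Laplace expansion along the first row.
  det : ∀ {n} → (Fin n → Fin n → Carrier) → Carrier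
  det {zero}  A = 1#
  det {suc n} A =
    sum λ j → ((- 1#) ^ toℕ j * A zero j) * det (λ r s → A (suc r) (punchIn j s))

------------------------------------------------------------------------
-- The polynomial ring ℚ[t]

-- Coefficient lists, constant term first.  Trailing zeros are allowed, so
-- equality of polynomials is _≈ₚ_ and not _≡_.
Poly : Set
Poly = List ℚ

coeff : Poly → ℕ → ℚ
coeff []      k       = 0ℚ
coeff (a ∷ p) zero    = a
coeff (a ∷ p) (suc k) = coeff p k

infix 4 _≈ₚ_

record _≈ₚ_ (p q : Poly) : Set where
  constructor coeffwise
  field
    coeff-≡ : ∀ k → coeff p k ≡ coeff q k

open _≈ₚ_ public

infixl 6 _+ₚ_
infixl 7 _*ₚ_

_+ₚ_ : Poly → Poly → Poly
[]      +ₚ q       = q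
(a ∷ p) +ₚ []      = a ∷ p
(a ∷ p) +ₚ (b ∷ q) = (a ℚ.+ b) ∷ (p +ₚ q)

-- (a + t p) q = a q + t (p q)
_*ₚ_ : Poly → Poly → Poly
[]      *ₚ q = []
(a ∷ p) *ₚ q = map (a ℚ.*_) q +ₚ (0ℚ ∷ (p *ₚ q))

ℚ[t] : RawRing 0ℓ 0ℓ
ℚ[t] = record
  { Carrier = Poly
  ; _≈_     = _≈ₚ_
  ; _+_     = _+ₚ_
  ; _*_     = _*ₚ_
  ; -_      = map (ℚ.-_)
  ; 0#      = []
  ; 1#      = 1ℚ ∷ []
  }

t : Poly
t = 0ℚ ∷ 1ℚ ∷ []

------------------------------------------------------------------------
-- The sequences and their Hankel determinants

-- Bₙ(t) = Σ_{k=0}^{n} (n C k)² tᵏ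
B : ℤ → Poly
B (+ n)    = applyUpTo (λ k → + ((n C k) ℕ.^ 2) / 1) (suc n)
B -[1+ _ ] = []

-- Cₙ₊₁(t) = Σ_{k=0}^{n} (n C k) ((n+1) C k) / (k+1) tᵏ
narayana : ℤ → Poly
narayana (+ zero)    = 1ℚ ∷ []
narayana (+ (suc n)) =
  applyUpTo (λ k → + ((n C k) ℕ.* (suc n C k)) / suc k) (suc n)
narayana -[1+ _ ]    = []

-- D a m n = det (a_{i+j+m})_{i,j=0}^{n-1}
D : (ℤ → Poly) → ℤ → ℕ → Poly
D a m n = Determinant.det ℚ[t] {n} λ i j → a (+ (toℕ i) ℤ.+ + (toℕ j) ℤ.+ m)

p : ℕ → ℕ → Poly
p m n = D narayana (+ m) n

{-# OPTIONS --safe #-}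
-- Let b = Σ Bₙ(t) xⁿ, Δ = (1 - (1 + t) x)² - 4 t x² and
-- a = 1 - (1 + t) x - 2 t Σ_{n≥1} Cₙ(t) xⁿ⁺¹. Coefficientwise identities between
-- binomials give 2 Δ θb + (θΔ) b = 0, where θ = x d/dx, and Δ b = a. The first
-- makes Δ b² constant, so a b = Δ b² = 1.
-- Multiplying every row of the Hankel matrix of xᵐ b by a is a unitriangular
-- column operation. It turns row i into xᵐ⁻ⁱ for i ≤ m, and the block below and
-- to the right becomes the unitriangular Toeplitz matrix of b times
-- (-a_{i+j+m+2}) = (2 t C_{i+j+m+1}(t)).
module Submission where

open import Defs
open import Algebra.Bundles using (CommutativeRing)
open import Algebra.Bundles.Raw using (RawRing)
import Algebra.Construct.Pointwise as Pointwise
import Algebra.Morphism.RingMonomorphism as RingMonomorphism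
open import Algebra.Morphism.Structures using (IsRingMonomorphism)
open import Data.Fin.Base using (Fin; zero; suc; toℕ; punchIn; fromℕ; _↑ˡ_)
open import Data.Fin.Properties using (toℕ-↑ˡ; toℕ-fromℕ; toℕ<n)
open import Data.Integer.Base as ℤ using (+_)
import Data.Integer.Properties as ℤ
open import Data.Nat.Base as ℕ using (ℕ; zero; suc; _≤_; _∸_; z≤n; s≤s; z<s; s<s)
open import Data.Nat.Combinatorics
  using (_C_; nC1≡n; nCk+nC[k+1]≡[n+1]C[k+1]; k>n⇒nCk≡0)
import Data.Nat.Properties as ℕ
open import Data.Product.Base using (_×_; _,_)
open import Data.Rational.Base as ℚ using (ℚ; 0ℚ; 1ℚ; _/_; fromℚᵘ)
import Data.Rational.Properties as ℚ
open import Data.Rational.Solver using (module +-*-Solver)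
open import Data.Rational.Unnormalised.Base as ℚᵘ using (mkℚᵘ; *≡*)
import Data.Rational.Unnormalised.Properties as ℚᵘ
open import Function.Base using (_∘_)
open import Level using (0ℓ)
open import Relation.Binary.PropositionalEquality as ≡
  using (_≡_; cong; cong₂; module ≡-Reasoning)

-- Power series

-- Removing the first i coefficients of xᵐ b leaves x^(m-i) b as long as i ≤ m, so a b = 1 makes
-- these rows monomials. Beyond row m the removed part contains coefficients of b, and a times a
-- tail of b has no such simple form. There a b = 1 is used again: its coefficient of x^(r+s+1) is
-- 0, and splitting that convolution sum says that (a times a tail of b) at s is the negative of (b
-- times a tail of a) at r. The roles of a and b are thereby exchanged: for fixed s the entry is, as
-- a function of r, a product with b, and a second unitriangular operation, now on rows, removes b.
--
-- The series a is the square root of Δ, but no square root is formed and a² = Δ is not verified,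
-- which would mean summing products of Narayana numbers. Both Δ b = a and the differential equation
-- are linear in b, hence three-term relations among Bₙ, Bₙ₊₁, Bₙ₊₂ that can be checked at each
-- power of t. Passing from derivative zero to constant uses that ℚ[t] has no integer torsion.

module PowerSeries {c ℓ} (R : CommutativeRing c ℓ) where

  open CommutativeRing R
  open import Algebra.Properties.Semiring.Mult semiring
    using (×-comm-*) renaming (_×_ to _·_)
  open import Algebra.Properties.CommutativeMonoid.Mult +-commutativeMonoid
    using (×-distrib-+)
  open import Algebra.Solver.Ring.NaturalCoefficients.Default commutativeSemiring
    using (solve; _:=_; _:+_; _:*_)
  open import Relation.Binary.Reasoning.Setoid setoid

  Series : Set c
  Series = ℕ → Carrier

  infix 4 _≋_
  _≋_ : Series → Series → Set ℓ
  f ≋ g = ∀ n → f n ≈ g n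

  infixl 6 _⊕_
  _⊕_ : Series → Series → Series
  (f ⊕ g) n = f n + g n

  -- The Cauchy product, by recursion on the left factor as f 0 + x (f ∘ suc). `_*ₚ_` recurses in
  -- the same way, which makes `coeff-*` immediate.
  infixl 7 _⋆_
  _⋆_ : Series → Series → Series
  (f ⋆ g) zero    = f 0 * g 0
  (f ⋆ g) (suc n) = f 0 * g (suc n) + ((f ∘ suc) ⋆ g) n

  𝟘 : Series
  𝟘 _ = 0#

  𝟙 : Series
  𝟙 zero    = 1#
  𝟙 (suc _) = 0#

  ⋆-cong : ∀ {f f′ g g′} → f ≋ f′ → g ≋ g′ → f ⋆ g ≋ f′ ⋆ g′
  ⋆-cong p q zero    = *-cong (p 0) (q 0)
  ⋆-cong p q (suc n) =
    +-cong (*-cong (p 0) (q (suc n))) (⋆-cong (p ∘ suc) q n)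

  ⋆-zeroˡ : ∀ f → 𝟘 ⋆ f ≋ 𝟘
  ⋆-zeroˡ f zero    = zeroˡ (f 0)
  ⋆-zeroˡ f (suc n) = begin
    0# * f (suc n) + (𝟘 ⋆ f) n  ≈⟨ +-cong (zeroˡ _) (⋆-zeroˡ f n) ⟩
    0# + 0#                     ≈⟨ +-identityˡ 0# ⟩
    0#                          ∎

  ⋆-constˡ : ∀ {f} → f ∘ suc ≋ 𝟘 → ∀ g n → (f ⋆ g) n ≈ f 0 * g n
  ⋆-constˡ {f} p g zero    = refl
  ⋆-constˡ {f} p g (suc n) = begin
    f 0 * g (suc n) + ((f ∘ suc) ⋆ g) n
      ≈⟨ +-congˡ (trans (⋆-cong p (λ _ → refl) n) (⋆-zeroˡ g n)) ⟩
    f 0 * g (suc n) + 0#  ≈⟨ +-identityʳ _ ⟩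
    f 0 * g (suc n)       ∎

  ⋆-identityˡ : ∀ f → 𝟙 ⋆ f ≋ f
  ⋆-identityˡ f n = trans (⋆-constˡ (λ _ → refl) f n) (*-identityˡ (f n))

  ⋆-distribʳ : ∀ h f g → (f ⊕ g) ⋆ h ≋ (f ⋆ h) ⊕ (g ⋆ h)
  ⋆-distribʳ h f g zero    = distribʳ (h 0) (f 0) (g 0)
  ⋆-distribʳ h f g (suc n) = begin
    (f 0 + g 0) * h (suc n) + (((f ∘ suc) ⊕ (g ∘ suc)) ⋆ h) n
      ≈⟨ +-congˡ (⋆-distribʳ h (f ∘ suc) (g ∘ suc) n) ⟩
    (f 0 + g 0) * h (suc n) + (((f ∘ suc) ⋆ h) n + ((g ∘ suc) ⋆ h) n)
      ≈⟨ solve 5 (λ a b c d e → (a :+ b) :* c :+ (d :+ e)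
                              := (a :* c :+ d) :+ (b :* c :+ e))
               refl (f 0) (g 0) (h (suc n)) _ _ ⟩
    (f ⋆ h) (suc n) + (g ⋆ h) (suc n)  ∎

  ⋆-scaleˡ : ∀ x f g n → ((λ k → x * f k) ⋆ g) n ≈ x * (f ⋆ g) n
  ⋆-scaleˡ x f g zero    = *-assoc x (f 0) (g 0)
  ⋆-scaleˡ x f g (suc n) = begin
    x * f 0 * g (suc n) + ((λ k → x * f (suc k)) ⋆ g) n
      ≈⟨ +-cong (*-assoc _ _ _) (⋆-scaleˡ x (f ∘ suc) g n) ⟩
    x * (f 0 * g (suc n)) + x * ((f ∘ suc) ⋆ g) n  ≈⟨ distribˡ x _ _ ⟨
    x * (f ⋆ g) (suc n)  ∎

  -- Mirror image of the defining recursion, peeling the right factor; commutativity follows from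
  -- it.
  ⋆-sucʳ : ∀ f g n → (f ⋆ g) (suc n) ≈ f (suc n) * g 0 + (f ⋆ (g ∘ suc)) n
  ⋆-sucʳ f g zero    = +-comm _ _
  ⋆-sucʳ f g (suc n) = begin
    f 0 * g (2 ℕ.+ n) + ((f ∘ suc) ⋆ g) (suc n)
      ≈⟨ +-congˡ (⋆-sucʳ (f ∘ suc) g n) ⟩
    f 0 * g (2 ℕ.+ n) + (f (2 ℕ.+ n) * g 0 + ((f ∘ suc) ⋆ (g ∘ suc)) n)
      ≈⟨ solve 3 (λ a b c → a :+ (b :+ c) := b :+ (a :+ c)) refl _ _ _ ⟩
    f (2 ℕ.+ n) * g 0 + (f ⋆ (g ∘ suc)) (suc n)  ∎

  ⋆-comm : ∀ f g → f ⋆ g ≋ g ⋆ f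
  ⋆-comm f g zero    = *-comm (f 0) (g 0)
  ⋆-comm f g (suc n) = begin
    f 0 * g (suc n) + ((f ∘ suc) ⋆ g) n
      ≈⟨ +-cong (*-comm _ _) (⋆-comm (f ∘ suc) g n) ⟩
    g (suc n) * f 0 + (g ⋆ (f ∘ suc)) n  ≈⟨ ⋆-sucʳ g f n ⟨
    (g ⋆ f) (suc n)                      ∎

  ⋆-assoc : ∀ f g h → (f ⋆ g) ⋆ h ≋ f ⋆ (g ⋆ h)
  ⋆-assoc f g h zero    = *-assoc (f 0) (g 0) (h 0)
  ⋆-assoc f g h (suc n) = begin
    f 0 * g 0 * h (suc n) + (((λ k → f 0 * g (suc k)) ⊕ ((f ∘ suc) ⋆ g)) ⋆ h) n
      ≈⟨ +-congˡ (⋆-distribʳ h _ _ n) ⟩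
    f 0 * g 0 * h (suc n)
      + (((λ k → f 0 * g (suc k)) ⋆ h) n + (((f ∘ suc) ⋆ g) ⋆ h) n)
      ≈⟨ +-congˡ (+-cong (⋆-scaleˡ (f 0) (g ∘ suc) h n)
                         (⋆-assoc (f ∘ suc) g h n)) ⟩
    f 0 * g 0 * h (suc n)
      + (f 0 * ((g ∘ suc) ⋆ h) n + ((f ∘ suc) ⋆ (g ⋆ h)) n)
      ≈⟨ solve 5 (λ a b c d e → a :* b :* c :+ (a :* d :+ e)
                              := a :* (b :* c :+ d) :+ e)
               refl (f 0) (g 0) (h (suc n)) _ _ ⟩
    (f ⋆ (g ⋆ h)) (suc n)  ∎

  seriesRing : CommutativeRing c ℓ
  seriesRing = record
    { isCommutativeRing = record
        { isRing = record
          { +-isAbelianGroup = Pointwise.isAbelianGroup ℕ +-isAbelianGroup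
          ; *-cong     = ⋆-cong
          ; *-assoc    = ⋆-assoc
          ; *-identity = ⋆-identityˡ , λ f n → trans (⋆-comm f 𝟙 n) (⋆-identityˡ f n)
          ; distrib    = (λ f g h n → begin
                (f ⋆ (g ⊕ h)) n            ≈⟨ ⋆-comm f (g ⊕ h) n ⟩
                ((g ⊕ h) ⋆ f) n            ≈⟨ ⋆-distribʳ f g h n ⟩
                ((g ⋆ f) ⊕ (h ⋆ f)) n      ≈⟨ +-cong (⋆-comm g f n) (⋆-comm h f n) ⟩
                ((f ⋆ g) ⊕ (f ⋆ h)) n      ∎)
              , ⋆-distribʳ
          }
        ; *-comm = ⋆-comm
        }
    }

  -- The Euler operator x d/dx.
  θ : Series → Series
  θ f n = n · f n

  -- The product rule, by induction on the degree. Since (θ f) ∘ suc = f′ + θ f′, one of the suc n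
  -- copies of (f′ ⋆ g) n supplies the f′, and the other n are expanded by induction.
  θ-⋆ : ∀ f g → θ (f ⋆ g) ≋ (θ f ⋆ g) ⊕ (f ⋆ θ g)
  θ-⋆ f g zero    = begin
    0#                   ≈⟨ +-identityˡ 0# ⟨
    0# + 0#              ≈⟨ +-cong (zeroˡ (g 0)) (zeroʳ (f 0)) ⟨
    0# * g 0 + f 0 * 0#  ∎
  θ-⋆ f g (suc n) = begin
    suc n · (f 0 * g (suc n) + (f′ ⋆ g) n)
      ≈⟨ ×-distrib-+ _ _ (suc n) ⟩
    suc n · (f 0 * g (suc n)) + ((f′ ⋆ g) n + n · (f′ ⋆ g) n)
      ≈⟨ +-cong (sym (×-comm-* (suc n) (f 0) (g (suc n))))
                (+-congˡ (θ-⋆ f′ g n)) ⟩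
    f 0 * θ g (suc n) + ((f′ ⋆ g) n + ((θ f′ ⋆ g) n + (f′ ⋆ θ g) n))
      ≈⟨ solve 4 (λ a b c d → a :+ (b :+ (c :+ d)) := b :+ c :+ (a :+ d))
               refl _ _ _ _ ⟩
    (f′ ⋆ g) n + (θ f′ ⋆ g) n + (f ⋆ θ g) (suc n)
      ≈⟨ +-congʳ (⋆-distribʳ g f′ (θ f′) n) ⟨
    ((θ f ∘ suc) ⋆ g) n + (f ⋆ θ g) (suc n)
      ≈⟨ +-congʳ (trans (+-congʳ (zeroˡ _)) (+-identityˡ _)) ⟨
    (θ f ⋆ g) (suc n) + (f ⋆ θ g) (suc n)  ∎
    where f′ = f ∘ suc

  -- Recursion on the offset, rather than f (k + n), lets `drop` cancel against `x^_·_` as an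
  -- equality of functions: shift f ∘ suc is f by eta.
  drop : ℕ → Series → Series
  drop zero    f = f
  drop (suc n) f = drop n (f ∘ suc)

  drop-≡ : ∀ n f k → drop n f k ≡ f (k ℕ.+ n)
  drop-≡ zero    f k = ≡.cong f (≡.sym (ℕ.+-identityʳ k))
  drop-≡ (suc n) f k = ≡.trans (drop-≡ n (f ∘ suc) k) (≡.cong f (≡.sym (ℕ.+-suc k n)))

  -- The coefficient of x^(i+j+1) in f g, split by whether the factor taken
  -- from g has degree > i or ≤ i.
  ⋆-split : ∀ i j f g → (f ⋆ g) (suc (i ℕ.+ j)) ≈
            (f ⋆ drop (suc i) g) j + (g ⋆ drop (suc j) f) i
  ⋆-split zero j f g = begin
    (f ⋆ g) (suc j)                               ≈⟨ ⋆-sucʳ f g j ⟩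
    f (suc j) * g 0 + (f ⋆ (g ∘ suc)) j           ≈⟨ +-comm _ _ ⟩
    (f ⋆ (g ∘ suc)) j + f (suc j) * g 0           ≈⟨ +-congˡ (*-comm _ _) ⟩
    (f ⋆ (g ∘ suc)) j + g 0 * f (suc j)
      ≡⟨ ≡.cong (λ z → (f ⋆ (g ∘ suc)) j + g 0 * z) (drop-≡ (suc j) f 0) ⟨
    (f ⋆ (g ∘ suc)) j + g 0 * drop (suc j) f 0    ∎
  ⋆-split (suc i) j f g = begin
    (f ⋆ g) (suc (suc i ℕ.+ j))
      ≈⟨ ⋆-sucʳ f g (suc i ℕ.+ j) ⟩
    f (suc (suc i ℕ.+ j)) * g 0 + (f ⋆ g′) (suc (i ℕ.+ j))
      ≈⟨ +-cong (*-comm _ _) (⋆-split i j f g′) ⟩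
    g 0 * f (suc (suc i ℕ.+ j)) + ((f ⋆ drop (suc i) g′) j + (g′ ⋆ drop (suc j) f) i)
      ≈⟨ solve 3 (λ a b c → a :+ (b :+ c) := b :+ (a :+ c)) refl _ _ _ ⟩
    (f ⋆ drop (suc i) g′) j + (g 0 * f (suc (suc i ℕ.+ j)) + (g′ ⋆ drop (suc j) f) i)
      ≡⟨ ≡.cong (λ z → (f ⋆ drop (suc i) g′) j + (g 0 * z + (g′ ⋆ drop (suc j) f) i))
           (≡.trans (drop-≡ (suc j) f (suc i)) (≡.cong (f ∘ suc) (ℕ.+-suc i j))) ⟨
    (f ⋆ drop (suc (suc i)) g) j + (g ⋆ drop (suc j) f) (suc i)  ∎
    where g′ = g ∘ suc

  shift : Series → Series
  shift f zero    = 0#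
  shift f (suc k) = f k

  x^_·_ : ℕ → Series → Series
  x^ zero  · f = f
  x^ suc m · f = shift (x^ m · f)

  ⋆-shift : ∀ f g → f ⋆ shift g ≋ shift (f ⋆ g)
  ⋆-shift f g zero    = zeroʳ (f 0)
  ⋆-shift f g (suc n) = begin
    (f ⋆ shift g) (suc n)          ≈⟨ ⋆-sucʳ f (shift g) n ⟩
    f (suc n) * 0# + (f ⋆ g) n     ≈⟨ +-congʳ (zeroʳ _) ⟩
    0# + (f ⋆ g) n                 ≈⟨ +-identityˡ _ ⟩
    (f ⋆ g) n                      ∎

  x^-cong : ∀ m {f g} → f ≋ g → x^ m · f ≋ x^ m · g
  x^-cong zero    p k       = p k
  x^-cong (suc m) p zero    = refl
  x^-cong (suc m) p (suc k) = x^-cong m p k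

  ⋆-x^ : ∀ m f g → f ⋆ (x^ m · g) ≋ x^ m · (f ⋆ g)
  ⋆-x^ zero    f g n = refl
  ⋆-x^ (suc m) f g n = trans (⋆-shift f (x^ m · g) n)
    (x^-cong 1 (⋆-x^ m f g) n)

  drop-x^ : ∀ i k f → drop i (x^ (i ℕ.+ k) · f) ≡ x^ k · f
  drop-x^ zero    k f = ≡.refl
  drop-x^ (suc i) k f = drop-x^ i k f

  drop-x^′ : ∀ m i f → drop (m ℕ.+ i) (x^ m · f) ≡ drop i f
  drop-x^′ zero    i f = ≡.refl
  drop-x^′ (suc m) i f = drop-x^′ m i f

  -- What removing column m does to a row, on infinite rows, so that the rows of a minor are again
  -- series.
  deleteAt : ℕ → Series → Series
  deleteAt zero    f         = f ∘ suc
  deleteAt (suc m) f zero    = f 0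
  deleteAt (suc m) f (suc k) = deleteAt m (f ∘ suc) k

  deleteAt-cong : ∀ m {f g} → f ≋ g → deleteAt m f ≋ deleteAt m g
  deleteAt-cong zero    p k       = p (suc k)
  deleteAt-cong (suc m) p zero    = p 0
  deleteAt-cong (suc m) p (suc k) = deleteAt-cong m (p ∘ suc) k

  deleteAt-≥ : ∀ m f j → deleteAt m f (m ℕ.+ j) ≡ f (suc (m ℕ.+ j))
  deleteAt-≥ zero    f j = ≡.refl
  deleteAt-≥ (suc m) f j = deleteAt-≥ m (f ∘ suc) j

  deleteAt-𝟘 : ∀ m k → deleteAt m 𝟘 k ≡ 0#
  deleteAt-𝟘 zero    k       = ≡.refl
  deleteAt-𝟘 (suc m) zero    = ≡.refl
  deleteAt-𝟘 (suc m) (suc k) = deleteAt-𝟘 m k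

  -- The deleted position lies to the right of the single 1, which therefore stays in place.
  deleteAt-x^ : ∀ {m k} → k ℕ.< m → deleteAt m (x^ k · 𝟙) ≋ x^ k · 𝟙
  deleteAt-x^ z<s               zero    = refl
  deleteAt-x^ (z<s {n = m})     (suc j) = reflexive (deleteAt-𝟘 m j)
  deleteAt-x^ (s<s k<m)         zero    = refl
  deleteAt-x^ (s<s k<m@(s≤s _)) (suc j) = deleteAt-x^ k<m j

  x^-low : ∀ {m k} f → k ℕ.< m → (x^ m · f) k ≡ 0#
  x^-low {k = zero}  f (s≤s _)       = ≡.refl
  x^-low {k = suc k} f (s≤s k<m)     = x^-low f k<m

  -- The differential equation says that Δ b² has derivative zero.
  inverse-square-root : (∀ n {x} → suc n · x ≈ 0# → x ≈ 0#) → ∀ {Δ b} →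
    Δ 0 * (b 0 * b 0) ≈ 1# → θ Δ ⋆ b ⊕ (Δ ⋆ θ b ⊕ Δ ⋆ θ b) ≋ 𝟘 →
    Δ ⋆ b ⋆ b ≋ 𝟙
  inverse-square-root torsion-free {Δ} {b} eq₀ ode n = trans (⋆-assoc Δ b b n) (go n)
    where
    open import Algebra.Solver.Ring.NaturalCoefficients.Default
      (CommutativeRing.commutativeSemiring seriesRing)
      using () renaming (solve to solveₛ; _:=_ to _:=ₛ_; _:+_ to _:+ₛ_; _:*_ to _:*ₛ_)
    go : Δ ⋆ (b ⋆ b) ≋ 𝟙
    go zero    = eq₀
    -- The coefficient in degree suc n of θ (Δ b²) is suc n times that of Δ b².
    go (suc n) = torsion-free n (begin
      θ (Δ ⋆ (b ⋆ b)) (suc n)  ≈⟨ θ-⋆ Δ (b ⋆ b) (suc n) ⟩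
      (θ Δ ⋆ (b ⋆ b)) (suc n) + (Δ ⋆ θ (b ⋆ b)) (suc n)
        ≈⟨ +-congˡ (⋆-cong {Δ} (λ _ → refl) (θ-⋆ b b) (suc n)) ⟩
      (θ Δ ⋆ (b ⋆ b) ⊕ Δ ⋆ (θ b ⋆ b ⊕ b ⋆ θ b)) (suc n)
        ≈⟨ solveₛ 4 (λ Δ Δ′ b b′ → Δ′ :*ₛ (b :*ₛ b) :+ₛ Δ :*ₛ (b′ :*ₛ b :+ₛ b :*ₛ b′)
                       :=ₛ (Δ′ :*ₛ b :+ₛ (Δ :*ₛ b′ :+ₛ Δ :*ₛ b′)) :*ₛ b)
             (λ _ → refl) Δ (θ Δ) b (θ b) (suc n) ⟩
      ((θ Δ ⋆ b ⊕ (Δ ⋆ θ b ⊕ Δ ⋆ θ b)) ⋆ b) (suc n)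
        ≈⟨ ⋆-cong ode (λ _ → refl) (suc n) ⟩
      (𝟘 ⋆ b) (suc n)  ≈⟨ ⋆-zeroˡ b (suc n) ⟩
      0#               ∎)

-- Determinants

module DeterminantProperties {c ℓ} (R : CommutativeRing c ℓ) where

  open CommutativeRing R hiding (zero)
  open Determinant rawRing using (det)
  open import Data.Vec.Functional using (_∷_)
  open import Algebra.Definitions.RawSemiring (RawRing.rawSemiring rawRing)
    using (_^_)
  import Algebra.Properties.Semiring.Sum semiring as Sum
  open import Algebra.Properties.Ring ring using (+-inverseˡ-unique)
  open import Algebra.Solver.Ring.NaturalCoefficients.Default commutativeSemiring
    using (solve; _:=_; _:+_; _:*_)
  open import Relation.Binary.Reasoning.Setoid setoid

  Matrix : ℕ → ℕ → Set c
  Matrix m n = Fin m → Fin n → Carrier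

  infix 4 _≈ₘ_
  _≈ₘ_ : ∀ {m n} → Matrix m n → Matrix m n → Set ℓ
  A ≈ₘ B = ∀ i j → A i j ≈ B i j

  infix 8 _ᵀ
  _ᵀ : ∀ {m n} → Matrix m n → Matrix n m
  (A ᵀ) i j = A j i

  sgn : ∀ {n} → Fin n → Carrier
  sgn j = (- 1#) ^ toℕ j

  withoutColumn : ∀ {m n} → Fin (suc n) → Matrix m (suc n) → Matrix m n
  withoutColumn j A r s = A r (punchIn j s)

  -- Since sum and det compute on the size, their arguments could not be inferred
  -- without these opaque copies.
  opaque
    ∑ : ∀ {n} → (Fin n → Carrier) → Carrier
    ∑ = Sum.sum

    ∑-suc : ∀ {n} (f : Fin (suc n) → Carrier) → ∑ f ≈ f zero + ∑ (f ∘ suc)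
    ∑-suc f = refl

    ∑-empty : ∀ (f : Fin 0 → Carrier) → ∑ f ≈ 0#
    ∑-empty f = refl

    ∑-cong : ∀ {n} {f g : Fin n → Carrier} → (∀ j → f j ≈ g j) → ∑ f ≈ ∑ g
    ∑-cong = Sum.sum-cong-≋

    ∑-zero : ∀ {n} {f : Fin n → Carrier} → (∀ j → f j ≈ 0#) → ∑ f ≈ 0#
    ∑-zero {n} p = trans (Sum.sum-cong-≋ p) (Sum.sum-replicate-zero n)

    ∑-distrib-+ : ∀ {n} (f g : Fin n → Carrier) → ∑ (λ j → f j + g j) ≈ ∑ f + ∑ g
    ∑-distrib-+ = Sum.∑-distrib-+

    ∑-comm : ∀ {m n} (f : Matrix m n) →
             ∑ (λ i → ∑ (λ j → f i j)) ≈ ∑ (λ j → ∑ (λ i → f i j))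
    ∑-comm = Sum.∑-comm

    *-distribˡ-∑ : ∀ {n} x (f : Fin n → Carrier) → x * ∑ f ≈ ∑ (λ j → x * f j)
    *-distribˡ-∑ = Sum.*-distribˡ-sum

    Det : ∀ {n} → Matrix n n → Carrier
    Det = det

    Det≡det : ∀ {n} (A : Matrix n n) → Det A ≡ det A
    Det≡det A = ≡.refl

    Det-empty : (A : Matrix 0 0) → Det A ≈ 1#
    Det-empty A = refl

    laplace : ∀ {n} (A : Matrix (suc n) (suc n)) →
      Det A ≈ ∑ (λ j → sgn j * A zero j * Det (withoutColumn j (A ∘ suc)))
    laplace A = refl

  det-cong : ∀ {n} {A B : Matrix n n} → A ≈ₘ B → Det A ≈ Det B
  det-cong {zero}  p = trans (Det-empty _) (sym (Det-empty _))
  det-cong {suc n} {A} {B} p = begin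
    Det A  ≈⟨ laplace A ⟩
    _      ≈⟨ ∑-cong (λ j → *-cong (*-congˡ (p zero j))
                                   (det-cong λ r s → p (suc r) (punchIn j s))) ⟩
    _      ≈⟨ laplace B ⟨
    Det B  ∎

  det-zero-row : ∀ {n} (A : Matrix (suc n) (suc n)) →
                 (∀ j → A zero j ≈ 0#) → Det A ≈ 0#
  det-zero-row A p = trans (laplace A) (∑-zero λ j → begin
    sgn j * A zero j * _  ≈⟨ *-congʳ (*-congˡ (p j)) ⟩
    sgn j * 0# * _        ≈⟨ *-congʳ (zeroʳ _) ⟩
    0# * _                ≈⟨ zeroˡ _ ⟩
    0#                    ∎)

  det-scale : ∀ {n} x (A : Matrix n n) →
              Det (λ i j → x * A i j) ≈ x ^ n * Det A
  det-scale {zero}  x A = begin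
    Det (λ i j → x * A i j)  ≈⟨ Det-empty _ ⟩
    1#                       ≈⟨ *-identityˡ 1# ⟨
    1# * 1#                  ≈⟨ *-congˡ (Det-empty A) ⟨
    1# * Det A               ∎
  det-scale {suc n} x A = begin
    Det (λ i j → x * A i j)  ≈⟨ laplace _ ⟩
    ∑ (λ j → sgn j * (x * A zero j) * Det (λ r s → x * minor j r s))
      ≈⟨ ∑-cong (λ j → trans (*-congˡ (det-scale x (minor j)))
           (solve 5 (λ e x a p d → e :* (x :* a) :* (p :* d)
                                := x :* p :* (e :* a :* d))
                  refl (sgn j) x (A zero j) (x ^ n) (Det (minor j)))) ⟩
    ∑ (λ j → x ^ suc n * (sgn j * A zero j * Det (minor j)))
      ≈⟨ *-distribˡ-∑ (x ^ suc n) (λ j → sgn j * A zero j * Det (minor j)) ⟨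
    x ^ suc n * ∑ (λ j → sgn j * A zero j * Det (minor j))  ≈⟨ *-congˡ (laplace A) ⟨
    x ^ suc n * Det A  ∎
    where minor = λ j → withoutColumn j (A ∘ suc)

  det-linear-row : ∀ {n} (x y : Fin (suc n) → Carrier) u (M : Matrix n (suc n)) →
    Det ((λ s → x s + u * y s) ∷ M) ≈ Det (x ∷ M) + u * Det (y ∷ M)
  det-linear-row x y u M = begin
    Det ((λ s → x s + u * y s) ∷ M)  ≈⟨ laplace _ ⟩
    ∑ (λ j → sgn j * (x j + u * y j) * d j)
      ≈⟨ ∑-cong (λ j → solve 5 (λ e x u y d → e :* (x :+ u :* y) :* d
                                     := e :* x :* d :+ u :* (e :* y :* d))
                             refl (sgn j) (x j) u (y j) (d j)) ⟩
    ∑ (λ j → sgn j * x j * d j + u * (sgn j * y j * d j))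
      ≈⟨ ∑-distrib-+ (λ j → sgn j * x j * d j) (λ j → u * (sgn j * y j * d j)) ⟩
    ∑ (λ j → sgn j * x j * d j) + ∑ (λ j → u * (sgn j * y j * d j))
      ≈⟨ +-cong (laplace (x ∷ M)) (*-distribˡ-∑ u (λ j → sgn j * y j * d j)) ⟨
    Det (x ∷ M) + u * ∑ (λ j → sgn j * y j * d j)  ≈⟨ +-congˡ (*-congˡ (laplace (y ∷ M))) ⟨
    Det (x ∷ M) + u * Det (y ∷ M)  ∎
    where d = λ j → Det (withoutColumn j M)

  -- Deleting column j and then column k of what remains deletes the same two
  -- columns as deleting j′ first and then k′.
  data Swapped : ∀ {n} (j : Fin (suc n)) (k : Fin n) (j′ : Fin (suc n)) (k′ : Fin n) → Set where
    here  : ∀ {n} (k : Fin (suc n)) → Swapped zero k (suc k) zero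
    there : ∀ {n} {j j′ : Fin (suc n)} {k k′} → Swapped j k j′ k′ →
            Swapped (suc j) (suc k) (suc j′) (suc k′)

  swapped-punchIn : ∀ {n} {j j′ : Fin (suc n)} {k k′} → Swapped j k j′ k′ →
                    punchIn j k ≡ j′
  swapped-punchIn (here k)  = ≡.refl
  swapped-punchIn (there w) = ≡.cong suc (swapped-punchIn w)

  swapped-punchIn′ : ∀ {n} {j j′ : Fin (suc n)} {k k′} → Swapped j k j′ k′ →
                     punchIn j′ k′ ≡ j
  swapped-punchIn′ (here k)  = ≡.refl
  swapped-punchIn′ (there w) = ≡.cong suc (swapped-punchIn′ w)

  swapped-punchIn² : ∀ {n} {j j′ : Fin (suc (suc n))} {k k′} → Swapped j k j′ k′ →
    ∀ s → punchIn j (punchIn k s) ≡ punchIn j′ (punchIn k′ s)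
  swapped-punchIn² (here k)  s       = ≡.refl
  swapped-punchIn² (there w) zero    = ≡.refl
  swapped-punchIn² (there w) (suc s) = ≡.cong suc (swapped-punchIn² w s)

  -- For `here` the exponents are k and k + 1. `there` raises all four indices by one, which
  -- multiplies both products by (-1)².
  swapped-sgn : ∀ {n} {j j′ : Fin (suc n)} {k k′} → Swapped j k j′ k′ →
                sgn j * sgn k + sgn j′ * sgn k′ ≈ 0#
  swapped-sgn (here k)  = begin
    1# * sgn k + (- 1# * sgn k) * 1#
      ≈⟨ +-congˡ (*-identityʳ _) ⟩
    1# * sgn k + - 1# * sgn k  ≈⟨ distribʳ (sgn k) 1# (- 1#) ⟨
    (1# + - 1#) * sgn k        ≈⟨ *-congʳ (-‿inverseʳ 1#) ⟩
    0# * sgn k           ≈⟨ zeroˡ _ ⟩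
    0#                   ∎
  swapped-sgn (there {j = j} {j′} {k} {k′} w) = begin
    (- 1# * sgn j) * (- 1# * sgn k) + (- 1# * sgn j′) * (- 1# * sgn k′)
      ≈⟨ solve 5 (λ m a b c d → (m :* a) :* (m :* b) :+ (m :* c) :* (m :* d)
                             := m :* m :* (a :* b :+ c :* d))
               refl (- 1#) (sgn j) (sgn k) (sgn j′) (sgn k′) ⟩
    - 1# * - 1# * (sgn j * sgn k + sgn j′ * sgn k′)  ≈⟨ *-congˡ (swapped-sgn w) ⟩
    - 1# * - 1# * 0#                                 ≈⟨ zeroʳ _ ⟩
    0#                                               ∎

  -- `here` matches the entries (0, k) and (k + 1, 0) of the array, and `there` is the recursion on
  -- the rest. Cancelling in pairs, instead of concluding from S = - S, avoids dividing by 2.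
  sum-antisymmetric : ∀ {n} (h : Fin (suc n) → Fin n → Carrier) →
    (∀ {j k j′ k′} → Swapped j k j′ k′ → h j k + h j′ k′ ≈ 0#) →
    ∑ (λ j → ∑ (h j)) ≈ 0#
  sum-antisymmetric {zero}  h p = ∑-zero λ j → ∑-empty (h j)
  sum-antisymmetric {suc n} h p = begin
    ∑ (λ j → ∑ (h j))  ≈⟨ ∑-suc _ ⟩
    ∑ (h zero) + ∑ (λ j → ∑ (h (suc j)))  ≈⟨ +-congˡ (∑-cong λ j → ∑-suc (h (suc j))) ⟩
    ∑ (h zero) + ∑ (λ j → h (suc j) zero + ∑ (λ k → h (suc j) (suc k)))
      ≈⟨ +-congˡ (∑-distrib-+ (λ j → h (suc j) zero) (λ j → ∑ (λ k → h (suc j) (suc k)))) ⟩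
    ∑ (h zero) + (∑ (λ j → h (suc j) zero) + rest)  ≈⟨ +-assoc _ _ _ ⟨
    ∑ (h zero) + ∑ (λ j → h (suc j) zero) + rest
      ≈⟨ +-cong (sym (∑-distrib-+ (h zero) (λ j → h (suc j) zero)))
                (sum-antisymmetric (λ j k → h (suc j) (suc k)) (λ w → p (there w))) ⟩
    ∑ (λ k → h zero k + h (suc k) zero) + 0#
      ≈⟨ +-congʳ (∑-zero (λ k → p (here k))) ⟩
    0# + 0#  ≈⟨ +-identityˡ 0# ⟩
    0#       ∎
    where rest = ∑ (λ j → ∑ (λ k → h (suc j) (suc k)))

  module _ {n} (N : Matrix n (suc (suc n))) where

    laplace₂ : (x y : Fin (suc (suc n)) → Carrier) → Fin (suc (suc n)) → Fin (suc n) → Carrier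
    laplace₂ x y j k = sgn j * x j * (sgn k * y (punchIn j k)
                         * Det (withoutColumn k (withoutColumn j N)))

    det-laplace₂ : ∀ x y → Det (x ∷ y ∷ N) ≈ ∑ (λ j → ∑ (laplace₂ x y j))
    det-laplace₂ x y = trans (laplace (x ∷ y ∷ N)) (∑-cong λ j → trans
      (*-congˡ (laplace (withoutColumn j (y ∷ N))))
      (*-distribˡ-∑ (sgn j * x j)
        (λ k → sgn k * y (punchIn j k) * Det (withoutColumn k (withoutColumn j N)))))

    -- Both terms take x in column j, y in column j′ and the same minor; only their signs differ.
    laplace₂-swapped : ∀ x y {j k j′ k′} → Swapped j k j′ k′ →
                       laplace₂ x y j k + laplace₂ y x j′ k′ ≈ 0#
    laplace₂-swapped x y {j} {k} {j′} {k′} w = begin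
      sgn j * x j * (sgn k * y (punchIn j k) * d)
        + sgn j′ * y j′ * (sgn k′ * x (punchIn j′ k′) * d′)
        ≡⟨ ≡.cong₂ (λ p q → sgn j * x j * (sgn k * y p * d)
                     + sgn j′ * y j′ * (sgn k′ * x q * d′))
             (swapped-punchIn w) (swapped-punchIn′ w) ⟩
      sgn j * x j * (sgn k * y j′ * d) + sgn j′ * y j′ * (sgn k′ * x j * d′)
        ≈⟨ +-congˡ (*-congˡ (*-congˡ (det-cong λ r s →
             reflexive (≡.cong (N r) (≡.sym (swapped-punchIn² w s)))))) ⟩
      sgn j * x j * (sgn k * y j′ * d) + sgn j′ * y j′ * (sgn k′ * x j * d)
        ≈⟨ solve 7 (λ a b c e x y d → a :* x :* (b :* y :* d) :+ c :* y :* (e :* x :* d)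
                                   := (a :* b :+ c :* e) :* (x :* y :* d))
                 refl (sgn j) (sgn k) (sgn j′) (sgn k′) (x j) (y j′) d ⟩
      (sgn j * sgn k + sgn j′ * sgn k′) * (x j * y j′ * d)  ≈⟨ *-congʳ (swapped-sgn w) ⟩
      0# * (x j * y j′ * d)                                 ≈⟨ zeroˡ _ ⟩
      0#                                                    ∎
      where
      d  = Det (withoutColumn k (withoutColumn j N))
      d′ = Det (withoutColumn k′ (withoutColumn j′ N))

    det-equal-rows : ∀ x → Det (x ∷ x ∷ N) ≈ 0#
    det-equal-rows x = trans (det-laplace₂ x x)
      (sum-antisymmetric (laplace₂ x x) (laplace₂-swapped x x))

    det-swap-rows : ∀ x y → Det (x ∷ y ∷ N) ≈ - Det (y ∷ x ∷ N)
    det-swap-rows x y = +-inverseˡ-unique _ _ (begin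
      Det (x ∷ y ∷ N) + Det (y ∷ x ∷ N)
        ≈⟨ +-cong (det-laplace₂ x y) (det-laplace₂ y x) ⟩
      ∑ (λ j → ∑ (laplace₂ x y j)) + ∑ (λ j → ∑ (laplace₂ y x j))
        ≈⟨ ∑-distrib-+ (λ j → ∑ (laplace₂ x y j)) (λ j → ∑ (laplace₂ y x j)) ⟨
      ∑ (λ j → ∑ (laplace₂ x y j) + ∑ (laplace₂ y x j))
        ≈⟨ ∑-cong (λ j → ∑-distrib-+ (laplace₂ x y j) (laplace₂ y x j)) ⟨
      ∑ (λ j → ∑ (h j))
        ≈⟨ sum-antisymmetric h h-swapped ⟩
      0#  ∎)
      where
      h : Fin (suc (suc n)) → Fin (suc n) → Carrier
      h j k = laplace₂ x y j k + laplace₂ y x j k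
      h-swapped : ∀ {j k j′ k′} → Swapped j k j′ k′ → h j k + h j′ k′ ≈ 0#
      h-swapped {j} {k} {j′} {k′} w = begin
        h j k + h j′ k′
          -- Each term with x on top is grouped with the term with y on top at the swapped pair.
          ≈⟨ solve 4 (λ a b c d → a :+ b :+ (c :+ d) := (a :+ d) :+ (b :+ c)) refl
                   (laplace₂ x y j k) (laplace₂ y x j k) (laplace₂ x y j′ k′) (laplace₂ y x j′ k′) ⟩
        _ ≈⟨ +-cong (laplace₂-swapped x y w) (laplace₂-swapped y x w) ⟩
        0# + 0#  ≈⟨ +-identityˡ 0# ⟩
        0#       ∎

  -- By induction on the number of rows. After a swap, expansion runs along y′, and its minors have
  -- a part of x on top, so the induction hypothesis clears the multiples of x from all later rows.
  -- The multiple of x left in y′ itself contributes a determinant with two equal rows.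
  det-add-first-row : ∀ {n} (x : Fin (suc n) → Carrier) (u : Fin n → Carrier)
    (N : Matrix n (suc n)) →
    Det (x ∷ λ r s → N r s + u r * x s) ≈ Det (x ∷ N)
  det-add-first-row {zero}  x u N = det-cong λ { zero j → refl }
  det-add-first-row {suc n} x u N = begin
    Det (x ∷ λ r s → N r s + u r * x s)
      ≈⟨ det-cong (λ { zero j → refl ; (suc zero) j → refl ; (suc (suc i)) j → refl }) ⟩
    Det (x ∷ y′ ∷ M)       ≈⟨ det-swap-rows M x y′ ⟩
    - Det (y′ ∷ x ∷ M)
      ≈⟨ -‿cong (trans (laplace (y′ ∷ x ∷ M)) (trans (∑-cong λ j → *-congˡ (begin
           Det (withoutColumn j (x ∷ M))
             ≈⟨ det-cong (λ { zero s → refl ; (suc r) s → refl }) ⟩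
           Det ((x ∘ punchIn j) ∷ λ r s → N (suc r) (punchIn j s) + u (suc r) * x (punchIn j s))
             ≈⟨ det-add-first-row (x ∘ punchIn j) (u ∘ suc) (withoutColumn j (N ∘ suc)) ⟩
           Det ((x ∘ punchIn j) ∷ withoutColumn j (N ∘ suc))
             ≈⟨ det-cong (λ { zero s → refl ; (suc r) s → refl }) ⟩
           Det (withoutColumn j (x ∷ (N ∘ suc)))  ∎))
           (sym (laplace (y′ ∷ x ∷ (N ∘ suc)))))) ⟩
    - Det (y′ ∷ x ∷ (N ∘ suc))
      ≈⟨ -‿cong (det-linear-row (N zero) x (u zero) (x ∷ (N ∘ suc))) ⟩
    - (Det (N zero ∷ x ∷ (N ∘ suc)) + u zero * Det (x ∷ x ∷ (N ∘ suc)))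
      ≈⟨ -‿cong (trans (+-congˡ (trans (*-congˡ (det-equal-rows (N ∘ suc) x)) (zeroʳ _)))
                       (+-identityʳ _)) ⟩
    - Det (N zero ∷ x ∷ (N ∘ suc))  ≈⟨ det-swap-rows (N ∘ suc) x (N zero) ⟨
    Det (x ∷ N zero ∷ (N ∘ suc))
      ≈⟨ det-cong (λ { zero j → refl ; (suc zero) j → refl ; (suc (suc i)) j → refl }) ⟩
    Det (x ∷ N)  ∎
    where
    y′ = λ s → N zero s + u zero * x s
    M  = λ r s → N (suc r) s + u (suc r) * x s

  -- The terms at the corner agree. In the others, expanding along row zero and then, by induction,
  -- along column zero gives the same double sum as the opposite order.
  det-first-column : ∀ {n} (A : Matrix (suc n) (suc n)) →
    Det A ≈ ∑ (λ i → sgn i * A i zero * Det (λ r s → A (punchIn i r) (suc s)))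
  det-first-column {zero}  A = trans (laplace A) (∑-cong λ { zero → *-congˡ (det-cong λ ()) })
  det-first-column {suc n} A = trans (laplace A) (trans (∑-suc _) (trans (+-congˡ (begin
    ∑ (λ j → sgn (suc j) * A zero (suc j) * Det (withoutColumn (suc j) (A ∘ suc)))
      ≈⟨ ∑-cong (λ j → *-congˡ (det-first-column (withoutColumn (suc j) (A ∘ suc)))) ⟩
    ∑ (λ j → sgn (suc j) * A zero (suc j) * ∑ (λ i → sgn i * A (suc i) zero * d i j))
      ≈⟨ ∑-cong (λ j → *-distribˡ-∑ (sgn (suc j) * A zero (suc j)) (λ i → sgn i * A (suc i) zero * d i j)) ⟩
    ∑ (λ j → ∑ (λ i → sgn (suc j) * A zero (suc j) * (sgn i * A (suc i) zero * d i j)))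
      ≈⟨ ∑-comm (λ j i → sgn (suc j) * A zero (suc j) * (sgn i * A (suc i) zero * d i j)) ⟩
    ∑ (λ i → ∑ (λ j → sgn (suc j) * A zero (suc j) * (sgn i * A (suc i) zero * d i j)))
      ≈⟨ ∑-cong (λ i → ∑-cong (λ j →
           solve 6 (λ m a b x y d → m :* a :* x :* (b :* y :* d) := m :* b :* y :* (a :* x :* d))
             refl (- 1#) (sgn j) (sgn i) (A zero (suc j)) (A (suc i) zero) (d i j))) ⟩
    ∑ (λ i → ∑ (λ j → sgn (suc i) * A (suc i) zero * (sgn j * A zero (suc j) * d i j)))
      ≈⟨ ∑-cong (λ i → trans (*-congˡ (laplace _))
           (*-distribˡ-∑ (sgn (suc i) * A (suc i) zero) (λ j → sgn j * A zero (suc j) * d i j))) ⟨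
    ∑ (λ i → sgn (suc i) * A (suc i) zero * Det (λ r s → A (punchIn (suc i) r) (suc s)))  ∎)) (sym (∑-suc _))))
    where
    d : Fin (suc n) → Fin (suc n) → Carrier
    d i j = Det (λ r s → A (suc (punchIn i r)) (suc (punchIn j s)))

  det-ᵀ : ∀ {n} (A : Matrix n n) → Det (A ᵀ) ≈ Det A
  det-ᵀ {zero}  A = det-cong λ ()
  det-ᵀ {suc n} A = begin
    Det (A ᵀ)  ≈⟨ laplace (A ᵀ) ⟩
    _          ≈⟨ ∑-cong (λ i → *-congˡ (det-ᵀ (λ r s → A (punchIn i r) (suc s)))) ⟩
    _          ≈⟨ det-first-column A ⟨
    Det A      ∎

  open PowerSeries R

  -- Multiplying every column by a series with constant term 1 is a unitriangular
  -- row operation.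
  det-⋆-columns : ∀ {n} {f} → f 0 ≈ 1# → (G : Fin n → Series) →
    Det (λ i j → (f ⋆ G j) (toℕ i)) ≈ Det (λ i j → G j (toℕ i))
  det-⋆-columns {zero}      f₀ G = det-cong λ ()
  det-⋆-columns {suc n} {f} f₀ G = begin
    Det (λ i j → (f ⋆ G j) (toℕ i))
      -- Row i + 1 is a row of f ⋆ (G j ∘ suc) plus f (suc i) times row zero. Once that multiple is
      -- removed, the minors have the original shape with tails in place of the series.
      ≈⟨ det-cong (λ { zero    j → trans (*-congʳ f₀) (*-identityˡ _)
                     ; (suc i) j → trans (⋆-sucʳ f (G j) (toℕ i)) (+-comm _ _) }) ⟩
    Det ((λ j → G j 0) ∷ λ i j → (f ⋆ (G j ∘ suc)) (toℕ i) + f (suc (toℕ i)) * G j 0)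
      ≈⟨ det-add-first-row (λ j → G j 0) (λ i → f (suc (toℕ i))) _ ⟩
    Det ((λ j → G j 0) ∷ λ i j → (f ⋆ (G j ∘ suc)) (toℕ i))
      ≈⟨ laplace _ ⟩
    _ ≈⟨ ∑-cong (λ j → *-congˡ (det-⋆-columns f₀ (λ s → G (punchIn j s) ∘ suc))) ⟩
    _ ≈⟨ laplace (λ i j → G j (toℕ i)) ⟨
    Det (λ i j → G j (toℕ i))  ∎

  det-⋆-rows : ∀ {n} {f} → f 0 ≈ 1# → (G : Fin n → Series) →
    Det (λ i j → (f ⋆ G i) (toℕ j)) ≈ Det (λ i j → G i (toℕ j))
  det-⋆-rows {f = f} f₀ G = begin
    Det (λ i j → (f ⋆ G i) (toℕ j))  ≈⟨ det-ᵀ (λ i j → (f ⋆ G i) (toℕ j)) ⟨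
    Det (λ i j → (f ⋆ G j) (toℕ i))  ≈⟨ det-⋆-columns f₀ G ⟩
    Det (λ i j → G j (toℕ i))        ≈⟨ det-ᵀ (λ i j → G i (toℕ j)) ⟩
    Det (λ i j → G i (toℕ j))        ∎

-- Hankel determinants of inverse series

module Hankel {c ℓ} (R : CommutativeRing c ℓ) where
  open CommutativeRing R hiding (zero)
  open PowerSeries R
  open DeterminantProperties R
  open import Algebra.Definitions.RawSemiring (RawRing.rawSemiring rawRing)
    using (_^_)
  open import Algebra.Properties.Semiring.Exp semiring using (^-homo-*)
  open import Algebra.Properties.Ring ring using (+-inverseˡ-unique)
  open import Algebra.Solver.Ring.NaturalCoefficients.Default commutativeSemiring
    using (solve; _:=_; _:*_)
  open import Relation.Binary.Reasoning.Setoid setoid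

  -- `fromℕ m ↑ˡ n` is column m, written so that it reduces together with m.
  ∑-x^ : ∀ m {n} (F : Fin (suc m ℕ.+ n) → Carrier) →
         ∑ (λ j → (x^ m · 𝟙) (toℕ j) * F j) ≈ F (fromℕ m ↑ˡ n)
  ∑-x^ zero F = begin
    ∑ (λ j → 𝟙 (toℕ j) * F j)  ≈⟨ ∑-suc _ ⟩
    1# * F zero + ∑ (λ j → 0# * F (suc j))
      ≈⟨ +-cong (*-identityˡ _) (∑-zero λ j → zeroˡ (F (suc j))) ⟩
    F zero + 0#                ≈⟨ +-identityʳ _ ⟩
    F zero                     ∎
  ∑-x^ (suc m) F = begin
    ∑ (λ j → (x^ suc m · 𝟙) (toℕ j) * F j)  ≈⟨ ∑-suc _ ⟩
    0# * F zero + ∑ (λ j → (x^ m · 𝟙) (toℕ j) * F (suc j))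
      ≈⟨ +-cong (zeroˡ _) (∑-x^ m (F ∘ suc)) ⟩
    0# + F (suc (fromℕ m ↑ˡ _))             ≈⟨ +-identityˡ _ ⟩
    F (suc (fromℕ m ↑ˡ _))                  ∎

  punchIn-deleteAt : ∀ m {n} (f : Series) (s : Fin (m ℕ.+ n)) →
    f (toℕ (punchIn (fromℕ m ↑ˡ n) s)) ≡ deleteAt m f (toℕ s)
  punchIn-deleteAt zero    f s       = ≡.refl
  punchIn-deleteAt (suc m) f zero    = ≡.refl
  punchIn-deleteAt (suc m) f (suc s) = punchIn-deleteAt m (f ∘ suc) s

  -- Row 0 has its only 1 in column m, so one minor survives, with sign (-1)ᵐ. The remaining
  -- monomial rows have their 1 to the left of the deleted column and form the same pattern for m -
  -- 1. The signs multiply to exponent m + (m - 1) + ... + 0.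
  det-antidiagonal : ∀ m {n} (g : ℕ → Series) →
    (∀ i k → i ℕ.+ k ≡ m → g i ≋ x^ k · 𝟙) →
    Det (λ (i j : Fin (suc m ℕ.+ n)) → g (toℕ i) (toℕ j)) ≈
    (- 1#) ^ (suc m C 2) * Det (λ (i j : Fin n) → g (suc m ℕ.+ toℕ i) (suc m ℕ.+ toℕ j))
  det-antidiagonal m {n} g p = begin
    Det (λ i j → g (toℕ i) (toℕ j))  ≈⟨ laplace _ ⟩
    ∑ (λ j → sgn j * g 0 (toℕ j) * d j)
      ≈⟨ ∑-cong (λ j → trans (*-congʳ (*-congˡ (p 0 m ≡.refl (toℕ j))))
           (solve 3 (λ e x d → e :* x :* d := x :* (e :* d)) refl (sgn j) _ (d j))) ⟩
    ∑ (λ j → (x^ m · 𝟙) (toℕ j) * (sgn j * d j))  ≈⟨ ∑-x^ m _ ⟩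
    sgn (fromℕ m ↑ˡ n) * d (fromℕ m ↑ˡ n)
      ≈⟨ *-cong (reflexive (≡.cong ((- 1#) ^_) (≡.trans (toℕ-↑ˡ (fromℕ m) n) (toℕ-fromℕ m))))
                (det-cong λ r s → reflexive (punchIn-deleteAt m (g (suc (toℕ r))) s)) ⟩
    (- 1#) ^ m * Det (λ (r s : Fin (m ℕ.+ n)) → deleteAt m (g (suc (toℕ r))) (toℕ s))
      ≈⟨ minor m p ⟩
    (- 1#) ^ (suc m C 2) * Det (λ (i j : Fin n) → g (suc m ℕ.+ toℕ i) (suc m ℕ.+ toℕ j))  ∎
    where
    d = λ j → Det (withoutColumn j (λ (r : Fin (m ℕ.+ n)) s → g (suc (toℕ r)) (toℕ s)))
    minor : ∀ m → (∀ i k → i ℕ.+ k ≡ m → g i ≋ x^ k · 𝟙) →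
      (- 1#) ^ m * Det (λ (r s : Fin (m ℕ.+ n)) → deleteAt m (g (suc (toℕ r))) (toℕ s)) ≈
      (- 1#) ^ (suc m C 2) * Det (λ (i j : Fin n) → g (suc m ℕ.+ toℕ i) (suc m ℕ.+ toℕ j))
    minor zero    p = refl
    minor (suc m) p = begin
      (- 1#) ^ suc m * Det (λ (r s : Fin (suc m ℕ.+ n)) → g′ (toℕ r) (toℕ s))
        ≈⟨ *-congˡ (det-antidiagonal m g′ λ i k i+k≡m j → trans
             (deleteAt-cong (suc m) (p (suc i) k (≡.cong suc i+k≡m)) j)
             (deleteAt-x^ (k<1+m i k i+k≡m) j)) ⟩
      (- 1#) ^ suc m * ((- 1#) ^ (suc m C 2) * Det (λ (i j : Fin n) → g′ (suc m ℕ.+ toℕ i) (suc m ℕ.+ toℕ j)))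
        ≈⟨ *-assoc _ _ _ ⟨
      (- 1#) ^ suc m * (- 1#) ^ (suc m C 2) * Det (λ (i j : Fin n) → g′ (suc m ℕ.+ toℕ i) (suc m ℕ.+ toℕ j))
        ≈⟨ *-cong (sym (^-homo-* (- 1#) (suc m) (suc m C 2)))
             (det-cong λ i j → reflexive (deleteAt-≥ (suc m) (g (suc (suc m ℕ.+ toℕ i))) (toℕ j))) ⟩
      (- 1#) ^ (suc m ℕ.+ suc m C 2) * Det (λ (i j : Fin n) → g (suc (suc m) ℕ.+ toℕ i) (suc (suc m) ℕ.+ toℕ j))
        -- Pascal's rule in the form C(m+1, 1) + C(m+1, 2) = C(m+2, 2).
        ≈⟨ *-congʳ (reflexive (≡.cong ((- 1#) ^_)
             (≡.trans (≡.cong (ℕ._+ suc m C 2) (≡.sym (nC1≡n (suc m))))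
                      (nCk+nC[k+1]≡[n+1]C[k+1] (suc m) 1)))) ⟩
      (- 1#) ^ (suc (suc m) C 2) * Det (λ (i j : Fin n) → g (suc (suc m) ℕ.+ toℕ i) (suc (suc m) ℕ.+ toℕ j))  ∎
      where
      g′ : ℕ → Series
      g′ i = deleteAt (suc m) (g (suc i))
      k<1+m : ∀ i k → i ℕ.+ k ≡ m → k ℕ.< suc m
      k<1+m i k ≡.refl = ℕ.s≤s (ℕ.m≤n+m k i)

  -- The remaining block starts at row and column m + 1. On the row side this offset is used up by
  -- the m zeros of xᵐ b and one coefficient of b; on the column side it survives, and the split of
  -- the product adds one more, giving m + 2.
  hankel-inverse : ∀ m {n} {a b : Series} → a 0 ≈ 1# → b 0 ≈ 1# → a ⋆ b ≋ 𝟙 →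
    Det (λ (i j : Fin (suc m ℕ.+ n)) → (x^ m · b) (toℕ i ℕ.+ toℕ j)) ≈
    (- 1#) ^ (suc m C 2) * Det (λ (i j : Fin n) → - a (toℕ i ℕ.+ toℕ j ℕ.+ suc (suc m)))
  hankel-inverse m {n} {a} {b} a₀ b₀ ab = begin
    Det (λ (i j : Fin (suc m ℕ.+ n)) → (x^ m · b) (toℕ i ℕ.+ toℕ j))
      ≈⟨ det-cong (λ i j → reflexive (≡.trans (≡.cong (x^ m · b) (ℕ.+-comm (toℕ i) (toℕ j)))
           (≡.sym (drop-≡ (toℕ i) (x^ m · b) (toℕ j))))) ⟩
    Det (λ (i j : Fin (suc m ℕ.+ n)) → drop (toℕ i) (x^ m · b) (toℕ j))
      ≈⟨ det-⋆-rows a₀ (λ i → drop (toℕ i) (x^ m · b)) ⟨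
    Det (λ (i j : Fin (suc m ℕ.+ n)) → g (toℕ i) (toℕ j))
      ≈⟨ det-antidiagonal m g top ⟩
    (- 1#) ^ (suc m C 2) * Det (λ (i j : Fin n) → g (suc m ℕ.+ toℕ i) (suc m ℕ.+ toℕ j))
      ≈⟨ *-congˡ (det-cong λ i j → bottom (toℕ i) (toℕ j)) ⟩
    (- 1#) ^ (suc m C 2) * Det (λ (i j : Fin n) → (b ⋆ (λ k → - drop (suc (suc m ℕ.+ toℕ j)) a k)) (toℕ i))
      -- Column j is b times one fixed series, so the factor b can be cancelled from all columns at
      -- once.
      ≈⟨ *-congˡ (det-⋆-columns b₀ _) ⟩
    (- 1#) ^ (suc m C 2) * Det (λ (i j : Fin n) → - drop (suc (suc m ℕ.+ toℕ j)) a (toℕ i))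
      ≈⟨ *-congˡ (det-cong λ i j → -‿cong (reflexive (≡.trans
           (drop-≡ (suc (suc m ℕ.+ toℕ j)) a (toℕ i)) (≡.cong a (index (toℕ i) (toℕ j)))))) ⟩
    (- 1#) ^ (suc m C 2) * Det (λ (i j : Fin n) → - a (toℕ i ℕ.+ toℕ j ℕ.+ suc (suc m)))  ∎
    where
    g : ℕ → Series
    g i = a ⋆ drop i (x^ m · b)

    top : ∀ i k → i ℕ.+ k ≡ m → g i ≋ x^ k · 𝟙
    top i k ≡.refl j = begin
      (a ⋆ drop i (x^ (i ℕ.+ k) · b)) j  ≡⟨ ≡.cong (λ f → (a ⋆ f) j) (drop-x^ i k b) ⟩
      (a ⋆ (x^ k · b)) j                 ≈⟨ ⋆-x^ k a b j ⟩
      (x^ k · (a ⋆ b)) j                 ≈⟨ x^-cong k ab j ⟩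
      (x^ k · 𝟙) j                       ∎

    bottom : ∀ i j → g (suc m ℕ.+ i) (suc m ℕ.+ j) ≈
             (b ⋆ (λ k → - drop (suc (suc m ℕ.+ j)) a k)) i
    bottom i j = begin
      (a ⋆ drop (suc m ℕ.+ i) (x^ m · b)) (suc m ℕ.+ j)
        ≡⟨ ≡.cong (λ f → (a ⋆ f) (suc m ℕ.+ j)) (≡.trans
             (≡.cong (λ e → drop e (x^ m · b)) (≡.sym (ℕ.+-suc m i))) (drop-x^′ m (suc i) b)) ⟩
      (a ⋆ drop (suc i) b) (suc m ℕ.+ j)
        -- The two halves of a positive-degree coefficient of a b = 1 add up to 0.
        ≈⟨ +-inverseˡ-unique _ _ (trans (sym (⋆-split i (suc m ℕ.+ j) a b)) (ab (suc (i ℕ.+ (suc m ℕ.+ j))))) ⟩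
      - (b ⋆ drop (suc (suc m ℕ.+ j)) a) i
        ≈⟨ -‿distribʳ-* b (drop (suc (suc m ℕ.+ j)) a) i ⟩
      (b ⋆ (λ k → - drop (suc (suc m ℕ.+ j)) a k)) i  ∎
      where open import Algebra.Properties.Ring (CommutativeRing.ring seriesRing) using (-‿distribʳ-*)

    index : ∀ i j → i ℕ.+ suc (suc m ℕ.+ j) ≡ i ℕ.+ j ℕ.+ suc (suc m)
    index i j = ≡.trans (≡.cong (i ℕ.+_) (ℕ.+-comm (suc (suc m)) j))
                        (≡.sym (ℕ.+-assoc i j (suc (suc m))))

-- ℚ[t] as a ring

open import Data.List.Base using ([]; _∷_; map; applyUpTo)
open import Algebra.Definitions.RawSemiring (RawRing.rawSemiring ℚ[t]) using (_^_)
open RawRing ℚ[t] using (_≈_; _*_; _+_; -_; 0#; 1#)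

private
  module Q = PowerSeries ℚ.+-*-commutativeRing

coeff-+ : ∀ p q k → coeff (p +ₚ q) k ≡ coeff p k ℚ.+ coeff q k
coeff-+ []      q       k       = ≡.sym (ℚ.+-identityˡ _)
coeff-+ (a ∷ p) []      k       = ≡.sym (ℚ.+-identityʳ _)
coeff-+ (a ∷ p) (b ∷ q) zero    = ≡.refl
coeff-+ (a ∷ p) (b ∷ q) (suc k) = coeff-+ p q k

coeff-map : ∀ {f : ℚ → ℚ} → f 0ℚ ≡ 0ℚ → ∀ p k → coeff (map f p) k ≡ f (coeff p k)
coeff-map f0 []      k       = ≡.sym f0
coeff-map f0 (a ∷ p) zero    = ≡.refl
coeff-map f0 (a ∷ p) (suc k) = coeff-map f0 p k

coeff-0∷ : ∀ p k → coeff (0ℚ ∷ p) k ≡ Q.shift (coeff p) k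
coeff-0∷ p zero    = ≡.refl
coeff-0∷ p (suc k) = ≡.refl

coeff-∷* : ∀ a p q k → coeff ((a ∷ p) *ₚ q) k ≡ a ℚ.* coeff q k ℚ.+ Q.shift (coeff (p *ₚ q)) k
coeff-∷* a p q k = ≡.trans (coeff-+ (map (a ℚ.*_) q) (0ℚ ∷ p *ₚ q) k)
  (cong₂ ℚ._+_ (coeff-map (ℚ.*-zeroʳ a) q k) (coeff-0∷ (p *ₚ q) k))

coeff-* : ∀ p q k → coeff (p *ₚ q) k ≡ (coeff p Q.⋆ coeff q) k
coeff-* []      q k       = ≡.sym (Q.⋆-zeroˡ (coeff q) k)
coeff-* (a ∷ p) q zero    = ≡.trans (coeff-∷* a p q 0) (ℚ.+-identityʳ _)
coeff-* (a ∷ p) q (suc k) = ≡.trans (coeff-∷* a p q (suc k))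
  (cong (a ℚ.* coeff q (suc k) ℚ.+_) (coeff-* p q k))

coeff-1 : ∀ k → coeff (1ℚ ∷ []) k ≡ Q.𝟙 k
coeff-1 zero    = ≡.refl
coeff-1 (suc k) = ≡.refl

-- The ring axioms for coefficient lists are pulled back along this map from power series over ℚ.
-- Injectivity is the definition of `_≈ₚ_`.
coeff-isRingMonomorphism : IsRingMonomorphism ℚ[t] (CommutativeRing.rawRing Q.seriesRing) coeff
coeff-isRingMonomorphism = record
  { isRingHomomorphism = record
    { isSemiringHomomorphism = record
      { isNearSemiringHomomorphism = record
        { +-isMonoidHomomorphism = record
          { isMagmaHomomorphism = record
            { isRelHomomorphism = record { cong = coeff-≡ }
            ; homo              = coeff-+
            }
          ; ε-homo = λ _ → ≡.refl
          }
        ; *-homo = coeff-*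
        }
      ; 1#-homo = coeff-1
      }
    ; -‿homo = coeff-map ≡.refl
    }
  ; injective = coeffwise
  }

polynomialRing : CommutativeRing 0ℓ 0ℓ
polynomialRing = record
  { isCommutativeRing = RingMonomorphism.isCommutativeRing coeff-isRingMonomorphism
      (CommutativeRing.isCommutativeRing Q.seriesRing)
  }

-- Natural numbers and fractions in ℚ

fromℚᵘ-homo-+ : ∀ p q → fromℚᵘ (p ℚᵘ.+ q) ≡ fromℚᵘ p ℚ.+ fromℚᵘ q
fromℚᵘ-homo-+ p q = ℚ.toℚᵘ-injective (ℚᵘ.≃-trans (ℚ.toℚᵘ-fromℚᵘ (p ℚᵘ.+ q)) (ℚᵘ.≃-sym
  (ℚᵘ.≃-trans (ℚ.toℚᵘ-homo-+ (fromℚᵘ p) (fromℚᵘ q))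
              (ℚᵘ.+-cong (ℚ.toℚᵘ-fromℚᵘ p) (ℚ.toℚᵘ-fromℚᵘ q)))))

fromℚᵘ-homo-* : ∀ p q → fromℚᵘ (p ℚᵘ.* q) ≡ fromℚᵘ p ℚ.* fromℚᵘ q
fromℚᵘ-homo-* p q = ℚ.toℚᵘ-injective (ℚᵘ.≃-trans (ℚ.toℚᵘ-fromℚᵘ (p ℚᵘ.* q)) (ℚᵘ.≃-sym
  (ℚᵘ.≃-trans (ℚ.toℚᵘ-homo-* (fromℚᵘ p) (fromℚᵘ q))
              (ℚᵘ.*-cong (ℚ.toℚᵘ-fromℚᵘ p) (ℚ.toℚᵘ-fromℚᵘ q)))))

ι : ℕ → ℚ
ι n = + n / 1

ι-+ : ∀ m n → ι (m ℕ.+ n) ≡ ι m ℚ.+ ι n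
ι-+ m n = ≡.trans
  (ℚ.fromℚᵘ-cong {mkℚᵘ (+ (m ℕ.+ n)) 0} {mkℚᵘ (+ m) 0 ℚᵘ.+ mkℚᵘ (+ n) 0}
    (*≡* (cong (ℤ._* + 1) (≡.sym (cong₂ ℤ._+_ (ℤ.*-identityʳ (+ m)) (ℤ.*-identityʳ (+ n)))))))
  (fromℚᵘ-homo-+ (mkℚᵘ (+ m) 0) (mkℚᵘ (+ n) 0))

ι-* : ∀ m n → ι (m ℕ.* n) ≡ ι m ℚ.* ι n
ι-* m n = ≡.trans
  (ℚ.fromℚᵘ-cong {mkℚᵘ (+ (m ℕ.* n)) 0} {mkℚᵘ (+ m) 0 ℚᵘ.* mkℚᵘ (+ n) 0}
    (*≡* (cong (ℤ._* + 1) (ℤ.pos-* m n))))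
  (fromℚᵘ-homo-* (mkℚᵘ (+ m) 0) (mkℚᵘ (+ n) 0))

-- Denominators other than 1 are handled only through this identity and the cancellation law drawn
-- from it.
suc-*-/ : ∀ m k → ι (suc k) ℚ.* (+ m / suc k) ≡ ι m
suc-*-/ m k = ≡.trans (≡.sym (fromℚᵘ-homo-* (mkℚᵘ (+ suc k) 0) (mkℚᵘ (+ m) k)))
  (ℚ.fromℚᵘ-cong {mkℚᵘ (+ suc k) 0 ℚᵘ.* mkℚᵘ (+ m) k} {mkℚᵘ (+ m) 0}
    (*≡* (≡.trans (ℤ.*-identityʳ _) (≡.trans (ℤ.*-comm (+ suc k) (+ m))
       (cong (λ d → + m ℤ.* + d) (≡.sym (ℕ.*-identityˡ (suc k))))))))

ι-suc-cancel : ∀ k {p q} → ι (suc k) ℚ.* p ≡ ι (suc k) ℚ.* q → p ≡ q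
ι-suc-cancel k {p} {q} eq = begin
  p                                ≡⟨ recover p ⟨
  (+ 1 / suc k) ℚ.* (ι (suc k) ℚ.* p)  ≡⟨ cong ((+ 1 / suc k) ℚ.*_) eq ⟩
  (+ 1 / suc k) ℚ.* (ι (suc k) ℚ.* q)  ≡⟨ recover q ⟩
  q                                ∎
  where
  open ≡-Reasoning
  recover : ∀ p → (+ 1 / suc k) ℚ.* (ι (suc k) ℚ.* p) ≡ p
  recover p = begin
    (+ 1 / suc k) ℚ.* (ι (suc k) ℚ.* p)  ≡⟨ ℚ.*-assoc (+ 1 / suc k) (ι (suc k)) p ⟨
    (+ 1 / suc k) ℚ.* ι (suc k) ℚ.* p    ≡⟨ cong (ℚ._* p) (ℚ.*-comm (+ 1 / suc k) (ι (suc k))) ⟩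
    ι (suc k) ℚ.* (+ 1 / suc k) ℚ.* p    ≡⟨ cong (ℚ._* p) (suc-*-/ 1 k) ⟩
    1ℚ ℚ.* p                             ≡⟨ ℚ.*-identityˡ p ⟩
    p                                    ∎

-- Binomials vanish beyond their range, so the coefficient formulas hold for every k and later
-- identities have no upper boundary case.
coeff-applyUpTo : ∀ (f : ℕ → ℚ) n → (∀ k → n ℕ.≤ k → f k ≡ 0ℚ) →
                  ∀ k → coeff (applyUpTo f n) k ≡ f k
coeff-applyUpTo f zero    f≡0 k       = ≡.sym (f≡0 k z≤n)
coeff-applyUpTo f (suc n) f≡0 zero    = ≡.refl
coeff-applyUpTo f (suc n) f≡0 (suc k) =
  coeff-applyUpTo (f ∘ suc) n (λ k n≤k → f≡0 (suc k) (s≤s n≤k)) k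

-- Binomial coefficients

binom : ℕ → Q.Series
binom n k = ι (n C k)

coeff-B : ∀ n k → coeff (B (+ n)) k ≡ binom n k ℚ.* binom n k
coeff-B n k = begin
  coeff (B (+ n)) k
    ≡⟨ coeff-applyUpTo (λ k → ι ((n C k) ℕ.^ 2)) (suc n)
         (λ k n<k → cong (λ c → ι (c ℕ.^ 2)) (k>n⇒nCk≡0 n<k)) k ⟩
  ι ((n C k) ℕ.* ((n C k) ℕ.* 1))  ≡⟨ cong (λ c → ι ((n C k) ℕ.* c)) (ℕ.*-identityʳ (n C k)) ⟩
  ι ((n C k) ℕ.* (n C k))          ≡⟨ ι-* (n C k) (n C k) ⟩
  binom n k ℚ.* binom n k      ∎
  where open ≡-Reasoning

coeff-narayana : ∀ n k → ι (suc k) ℚ.* coeff (narayana (+ suc n)) k ≡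
                 binom n k ℚ.* binom (suc n) k
coeff-narayana n k = begin
  ι (suc k) ℚ.* coeff (narayana (+ suc n)) k
    ≡⟨ cong (ι (suc k) ℚ.*_) (coeff-applyUpTo (λ k → + ((n C k) ℕ.* (suc n C k)) / suc k) (suc n)
         (λ k n<k → ι-suc-cancel k (begin
            ι (suc k) ℚ.* (+ ((n C k) ℕ.* (suc n C k)) / suc k)  ≡⟨ suc-*-/ ((n C k) ℕ.* (suc n C k)) k ⟩
            ι ((n C k) ℕ.* (suc n C k))  ≡⟨ cong (λ c → ι (c ℕ.* (suc n C k))) (k>n⇒nCk≡0 n<k) ⟩
            0ℚ                       ≡⟨ ℚ.*-zeroʳ (ι (suc k)) ⟨
            ι (suc k) ℚ.* 0ℚ         ∎)) k) ⟩
  ι (suc k) ℚ.* (+ ((n C k) ℕ.* (suc n C k)) / suc k)  ≡⟨ suc-*-/ ((n C k) ℕ.* (suc n C k)) k ⟩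
  ι ((n C k) ℕ.* (suc n C k))                         ≡⟨ ι-* (n C k) (suc n C k) ⟩
  binom n k ℚ.* binom (suc n) k                   ∎
  where open ≡-Reasoning

-- `Q.shift` stands for the index k - 1 and is 0 at k = 0, which keeps the rule uniform in k.
pascal : ∀ n k → binom (suc n) k ≡ binom n k ℚ.+ Q.shift (binom n) k
pascal n zero    = ≡.refl
pascal n (suc k) = begin
  ι (suc n C suc k)              ≡⟨ cong ι (nCk+nC[k+1]≡[n+1]C[k+1] n k) ⟨
  ι ((n C k) ℕ.+ (n C suc k))        ≡⟨ ι-+ (n C k) (n C suc k) ⟩
  binom n k ℚ.+ binom n (suc k)  ≡⟨ ℚ.+-comm (binom n k) (binom n (suc k)) ⟩
  binom n (suc k) ℚ.+ binom n k  ∎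
  where open ≡-Reasoning

-- This is k C(n+1, k) = (n+1) C(n, k-1), with C(n+1, k) expanded so that only one upper index
-- occurs. The induction on n adds the instances at k + 1 and k, using k + 1 = 1 + k in the second.
absorption : ∀ n k → ι k ℚ.* (binom n k ℚ.+ Q.shift (binom n) k) ≡ ι (suc n) ℚ.* Q.shift (binom n) k
absorption n       zero          = ≡.trans (ℚ.*-zeroˡ (binom n 0 ℚ.+ 0ℚ)) (≡.sym (ℚ.*-zeroʳ (ι (suc n))))
absorption zero    (suc zero)    = ≡.refl
absorption zero    (suc (suc k)) = ℚ.*-zeroʳ (ι (2 ℕ.+ k))
absorption (suc n) (suc k)       = begin
  ι (suc k) ℚ.* (binom (suc n) (suc k) ℚ.+ binom (suc n) k)
    ≡⟨ cong₂ (λ u v → ι (suc k) ℚ.* (u ℚ.+ v)) (pascal n (suc k)) (pascal n k) ⟩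
  ι (suc k) ℚ.* (x ℚ.+ y ℚ.+ (y ℚ.+ z))
    ≡⟨ ℚ.*-distribˡ-+ (ι (suc k)) (x ℚ.+ y) (y ℚ.+ z) ⟩
  ι (suc k) ℚ.* (x ℚ.+ y) ℚ.+ ι (suc k) ℚ.* (y ℚ.+ z)
    ≡⟨ cong₂ ℚ._+_ (absorption n (suc k)) (≡.trans (cong (ℚ._* (y ℚ.+ z)) (ι-+ 1 k))
         (≡.trans (ℚ.*-distribʳ-+ (y ℚ.+ z) 1ℚ (ι k)) (cong (1ℚ ℚ.* (y ℚ.+ z) ℚ.+_) (absorption n k)))) ⟩
  ι (suc n) ℚ.* y ℚ.+ (1ℚ ℚ.* (y ℚ.+ z) ℚ.+ ι (suc n) ℚ.* z)
    ≡⟨ solve 3 (λ N y z → N :* y :+ (con 1ℚ :* (y :+ z) :+ N :* z) := (con 1ℚ :+ N) :* (y :+ z))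
         ≡.refl (ι (suc n)) y z ⟩
  (1ℚ ℚ.+ ι (suc n)) ℚ.* (y ℚ.+ z)
    ≡⟨ cong₂ ℚ._*_ (ι-+ 1 (suc n)) (pascal n k) ⟨
  ι (suc (suc n)) ℚ.* binom (suc n) k  ∎
  where
  open ≡-Reasoning
  open +-*-Solver
  x = binom n (suc k)
  y = binom n k
  z = Q.shift (binom n) k

-- The generating functions

private
  module P = CommutativeRing polynomialRing

open PowerSeries polynomialRing
open DeterminantProperties polynomialRing
open Hankel polynomialRing
open import Algebra.Properties.Ring P.ring using (-‿involutive)
open import Algebra.Properties.Semiring.Mult P.semiring
  using (×-assoc-*; ×-comm-*) renaming (_×_ to _·_)

2ℚ -1ℚ -2ℚ : ℚ
2ℚ  = + 2 / 1
-1ℚ = ℤ.-[1+ 0 ] / 1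
-2ℚ = ℤ.-[1+ 1 ] / 1

-- (1 - (1 + t) x)² - 4 t x²
Δ : Series
Δ 0 = 1#
Δ 1 = -2ℚ ∷ -2ℚ ∷ []
Δ 2 = 1ℚ ∷ -2ℚ ∷ 1ℚ ∷ []
Δ (suc (suc (suc _))) = 0#

-- 1 - (1 + t) x - 2 t Σ_{n≥1} Cₙ(t) xⁿ⁺¹
1/B : Series
1/B 0 = 1#
1/B 1 = -1ℚ ∷ -1ℚ ∷ []
1/B (suc (suc n)) = - ((1# + 1#) * t * narayana (+ suc n))

Bₓ : Series
Bₓ n = B (+ n)

coeff-· : ∀ n p k → coeff (n · p) k ≡ ι n ℚ.* coeff p k
coeff-· zero    p k = ≡.sym (ℚ.*-zeroˡ (coeff p k))
coeff-· (suc n) p k = begin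
  coeff (p + n · p) k                        ≡⟨ coeff-+ p (n · p) k ⟩
  coeff p k ℚ.+ coeff (n · p) k              ≡⟨ cong (coeff p k ℚ.+_) (coeff-· n p k) ⟩
  coeff p k ℚ.+ ι n ℚ.* coeff p k
    ≡⟨ solve 2 (λ p N → p :+ N :* p := (con 1ℚ :+ N) :* p) ≡.refl (coeff p k) (ι n) ⟩
  (1ℚ ℚ.+ ι n) ℚ.* coeff p k                 ≡⟨ cong (ℚ._* coeff p k) (ι-+ 1 n) ⟨
  ι (suc n) ℚ.* coeff p k                    ∎
  where open ≡-Reasoning ; open +-*-Solver

·-torsion-free : ∀ n {p} → suc n · p ≈ 0# → p ≈ 0#
·-torsion-free n {p} eq = coeffwise λ k → ι-suc-cancel n (begin
  ι (suc n) ℚ.* coeff p k  ≡⟨ coeff-· (suc n) p k ⟨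
  coeff (suc n · p) k      ≡⟨ coeff-≡ eq k ⟩
  0ℚ                       ≡⟨ ℚ.*-zeroʳ (ι (suc n)) ⟨
  ι (suc n) ℚ.* 0ℚ         ∎)
  where open ≡-Reasoning

coeff-linear* : ∀ a b p k → coeff ((a ∷ b ∷ []) * p) k ≡
                a ℚ.* coeff p k ℚ.+ b ℚ.* Q.shift (coeff p) k
coeff-linear* a b p zero = begin
  coeff ((a ∷ b ∷ []) * p) 0 ≡⟨ coeff-∷* a (b ∷ []) p 0 ⟩
  a ℚ.* coeff p 0 ℚ.+ 0ℚ     ≡⟨ cong (a ℚ.* coeff p 0 ℚ.+_) (ℚ.*-zeroʳ b) ⟨
  a ℚ.* coeff p 0 ℚ.+ b ℚ.* 0ℚ ∎
  where open ≡-Reasoning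
coeff-linear* a b p (suc k) = begin
  coeff ((a ∷ b ∷ []) * p) (suc k) ≡⟨ coeff-∷* a (b ∷ []) p (suc k) ⟩
  a ℚ.* coeff p (suc k) ℚ.+ coeff ((b ∷ []) * p) k
    ≡⟨ cong (a ℚ.* coeff p (suc k) ℚ.+_) (begin
         coeff ((b ∷ []) * p) k                ≡⟨ coeff-∷* b [] p k ⟩
         b ℚ.* coeff p k ℚ.+ Q.shift (coeff []) k ≡⟨ cong (b ℚ.* coeff p k ℚ.+_) (shift-0 k) ⟩
         b ℚ.* coeff p k ℚ.+ 0ℚ                ≡⟨ ℚ.+-identityʳ _ ⟩
         b ℚ.* coeff p k                       ∎) ⟩
  a ℚ.* coeff p (suc k) ℚ.+ b ℚ.* coeff p k ∎
  where
  open ≡-Reasoning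
  shift-0 : ∀ k → Q.shift (coeff []) k ≡ 0ℚ
  shift-0 zero    = ≡.refl
  shift-0 (suc k) = ≡.refl

coeff-quadratic* : ∀ a b c p k → coeff ((a ∷ b ∷ c ∷ []) * p) k ≡
  a ℚ.* coeff p k ℚ.+ (b ℚ.* Q.shift (coeff p) k ℚ.+ c ℚ.* Q.shift (Q.shift (coeff p)) k)
coeff-quadratic* a b c p zero = begin
  coeff ((a ∷ b ∷ c ∷ []) * p) 0 ≡⟨ coeff-∷* a (b ∷ c ∷ []) p 0 ⟩
  a ℚ.* coeff p 0 ℚ.+ 0ℚ
    ≡⟨ cong (a ℚ.* coeff p 0 ℚ.+_) (cong₂ ℚ._+_ (ℚ.*-zeroʳ b) (ℚ.*-zeroʳ c)) ⟨
  a ℚ.* coeff p 0 ℚ.+ (b ℚ.* 0ℚ ℚ.+ c ℚ.* 0ℚ) ∎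
  where open ≡-Reasoning
coeff-quadratic* a b c p (suc k) = ≡.trans (coeff-∷* a (b ∷ c ∷ []) p (suc k))
  (cong (a ℚ.* coeff p (suc k) ℚ.+_) (coeff-linear* b c p k))

-- With x, y, z for the binomials of N over k, k - 1, k - 2, all coefficients of
-- tᵏ below are polynomials in x, y, z, and e₁, e₂ generate the relations
-- between them.
module Coefficients (N k : ℕ) where
  x y z : ℚ
  x = binom N k
  y = Q.shift (binom N) k
  z = Q.shift (Q.shift (binom N)) k

  square : ℚ → ℚ
  square u = u ℚ.* u

  shift-square : ∀ {f g} → (∀ k → f k ≡ square (g k)) → ∀ k → Q.shift f k ≡ square (Q.shift g k)
  shift-square f≡g² zero    = ≡.refl
  shift-square f≡g² (suc k) = f≡g² k

  shift-pascal : ∀ n k → Q.shift (binom (suc n)) k ≡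
                 Q.shift (binom n) k ℚ.+ Q.shift (Q.shift (binom n)) k
  shift-pascal n zero    = ≡.refl
  shift-pascal n (suc k) = pascal n k

  B₀ : coeff (Bₓ N) k ≡ square x
  B₀ = coeff-B N k

  tB₀ : Q.shift (coeff (Bₓ N)) k ≡ square y
  tB₀ = shift-square (coeff-B N) k

  t²B₀ : Q.shift (Q.shift (coeff (Bₓ N))) k ≡ square z
  t²B₀ = shift-square (shift-square (coeff-B N)) k

  B₁ : coeff (Bₓ (suc N)) k ≡ square (x ℚ.+ y)
  B₁ = ≡.trans (coeff-B (suc N) k) (cong square (pascal N k))

  tB₁ : Q.shift (coeff (Bₓ (suc N))) k ≡ square (y ℚ.+ z)
  tB₁ = ≡.trans (shift-square (coeff-B (suc N)) k) (cong square (shift-pascal N k))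

  B₂ : coeff (Bₓ (suc (suc N))) k ≡ square (x ℚ.+ y ℚ.+ (y ℚ.+ z))
  B₂ = ≡.trans (coeff-B (suc (suc N)) k) (cong square
    (≡.trans (pascal (suc N) k) (cong₂ ℚ._+_ (pascal N k) (shift-pascal N k))))

  e₁ : ι k ℚ.* (x ℚ.+ y) ℚ.+ ℚ.- ((1ℚ ℚ.+ ι N) ℚ.* y) ≡ 0ℚ
  e₁ = ≡.trans
    (cong (λ u → u ℚ.+ ℚ.- ((1ℚ ℚ.+ ι N) ℚ.* y))
      (≡.trans (absorption N k) (cong (ℚ._* y) (ι-+ 1 N))))
    (ℚ.+-inverseʳ ((1ℚ ℚ.+ ι N) ℚ.* y))

  -- Absorption at k - 1, that is (k - 1)(y + z) = (N + 1) z, with y + z moved across so that it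
  -- makes sense, trivially, at k = 0.
  e₂ : ι k ℚ.* (y ℚ.+ z) ℚ.+ ℚ.- ((1ℚ ℚ.+ ι N) ℚ.* z ℚ.+ (y ℚ.+ z)) ≡ 0ℚ
  e₂ = shifted k
    where
    open ≡-Reasoning
    open +-*-Solver
    shifted : ∀ k → let y = Q.shift (binom N) k; z = Q.shift (Q.shift (binom N)) k in
      ι k ℚ.* (y ℚ.+ z) ℚ.+ ℚ.- ((1ℚ ℚ.+ ι N) ℚ.* z ℚ.+ (y ℚ.+ z)) ≡ 0ℚ
    shifted zero    = solve 1 (λ N →
      con 0ℚ :* (con 0ℚ :+ con 0ℚ)
        :+ :- ((con 1ℚ :+ N) :* con 0ℚ :+ (con 0ℚ :+ con 0ℚ)) := con 0ℚ) ≡.refl (ι N)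
    shifted (suc k) = begin
      ι (suc k) ℚ.* s ℚ.+ ℚ.- (M ℚ.+ s) ≡⟨ cong (λ K → K ℚ.* s ℚ.+ ℚ.- (M ℚ.+ s)) (ι-+ 1 k) ⟩
      (1ℚ ℚ.+ ι k) ℚ.* s ℚ.+ ℚ.- (M ℚ.+ s)
        ≡⟨ solve 3 (λ K M s → (con 1ℚ :+ K) :* s :+ :- (M :+ s) := K :* s :+ :- M) ≡.refl (ι k) M s ⟩
      ι k ℚ.* s ℚ.+ ℚ.- M
        ≡⟨ cong (λ u → u ℚ.+ ℚ.- M) (≡.trans (absorption N k) (cong (ℚ._* Q.shift (binom N) k) (ι-+ 1 N))) ⟩
      M ℚ.+ ℚ.- M  ≡⟨ ℚ.+-inverseʳ M ⟩
      0ℚ ∎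
      where
      s = binom N k ℚ.+ Q.shift (binom N) k
      M = (1ℚ ℚ.+ ι N) ℚ.* Q.shift (binom N) k

coeff-2t* : ∀ q k → coeff ((1# + 1#) * t * q) k ≡ 2ℚ ℚ.* Q.shift (coeff q) k
coeff-2t* q k = begin
  coeff ((1# + 1#) * t * q) k                ≡⟨ coeff-linear* 0ℚ 2ℚ q k ⟩
  0ℚ ℚ.* coeff q k ℚ.+ 2ℚ ℚ.* Q.shift (coeff q) k
    ≡⟨ cong (ℚ._+ 2ℚ ℚ.* Q.shift (coeff q) k) (ℚ.*-zeroˡ (coeff q k)) ⟩
  0ℚ ℚ.+ 2ℚ ℚ.* Q.shift (coeff q) k          ≡⟨ ℚ.+-identityˡ _ ⟩
  2ℚ ℚ.* Q.shift (coeff q) k                 ∎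
  where open ≡-Reasoning

-- An identity in three independent variables. The minor y² - x z on the right is a Narayana
-- coefficient by `t-narayana`.
Δ⋆B-identity : ∀ x y z →
  let sq = λ u → u ℚ.* u in
  sq (x ℚ.+ y ℚ.+ (y ℚ.+ z)) ℚ.+ (-2ℚ ℚ.* sq (x ℚ.+ y) ℚ.+ -2ℚ ℚ.* sq (y ℚ.+ z)
    ℚ.+ (1ℚ ℚ.* sq x ℚ.+ (-2ℚ ℚ.* sq y ℚ.+ 1ℚ ℚ.* sq z)))
  ≡ ℚ.- (2ℚ ℚ.* (sq y ℚ.+ ℚ.- (x ℚ.* z)))
Δ⋆B-identity = solve 3 (λ x y z →
  let sq = λ u → u :* u in
  sq (x :+ y :+ (y :+ z)) :+ (con -2ℚ :* sq (x :+ y) :+ con -2ℚ :* sq (y :+ z)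
    :+ (con 1ℚ :* sq x :+ (con -2ℚ :* sq y :+ con 1ℚ :* sq z)))
  := :- (con 2ℚ :* (sq y :+ :- (x :* z)))) ≡.refl
  where open +-*-Solver

coeff-Δ : ∀ b₀ b₁ b₂ k → coeff (b₂ + (Δ 1 * b₁ + Δ 2 * b₀)) k ≡
  coeff b₂ k ℚ.+ (-2ℚ ℚ.* coeff b₁ k ℚ.+ -2ℚ ℚ.* Q.shift (coeff b₁) k
    ℚ.+ (1ℚ ℚ.* coeff b₀ k ℚ.+ (-2ℚ ℚ.* Q.shift (coeff b₀) k ℚ.+ 1ℚ ℚ.* Q.shift (Q.shift (coeff b₀)) k)))
coeff-Δ b₀ b₁ b₂ k = begin
  coeff (b₂ + (Δ 1 * b₁ + Δ 2 * b₀)) k  ≡⟨ coeff-+ b₂ (Δ 1 * b₁ + Δ 2 * b₀) k ⟩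
  coeff b₂ k ℚ.+ coeff (Δ 1 * b₁ + Δ 2 * b₀) k
    ≡⟨ cong (coeff b₂ k ℚ.+_) (coeff-+ (Δ 1 * b₁) (Δ 2 * b₀) k) ⟩
  coeff b₂ k ℚ.+ (coeff (Δ 1 * b₁) k ℚ.+ coeff (Δ 2 * b₀) k)
    ≡⟨ cong (coeff b₂ k ℚ.+_) (cong₂ ℚ._+_ (coeff-linear* -2ℚ -2ℚ b₁ k) (coeff-quadratic* 1ℚ -2ℚ 1ℚ b₀ k)) ⟩
  _ ∎
  where open ≡-Reasoning

-- Stated for arbitrary polynomials because the conversion checker would
-- otherwise unfold the coefficient lists of B and narayana.
Δ⋆B-coeff′ : ∀ {x y z} b₀ b₁ b₂ q k → let sq = λ u → u ℚ.* u in
  coeff b₀ k ≡ sq x → Q.shift (coeff b₀) k ≡ sq y → Q.shift (Q.shift (coeff b₀)) k ≡ sq z →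
  coeff b₁ k ≡ sq (x ℚ.+ y) → Q.shift (coeff b₁) k ≡ sq (y ℚ.+ z) →
  coeff b₂ k ≡ sq (x ℚ.+ y ℚ.+ (y ℚ.+ z)) →
  Q.shift (coeff q) k ≡ sq y ℚ.+ ℚ.- (x ℚ.* z) →
  coeff (b₂ + (Δ 1 * b₁ + Δ 2 * b₀)) k ≡ coeff (- ((1# + 1#) * t * q)) k
Δ⋆B-coeff′ {x} {y} {z} b₀ b₁ b₂ q k p₀ p₁ p₂ p₃ p₄ p₅ p₆ = begin
  coeff (b₂ + (Δ 1 * b₁ + Δ 2 * b₀)) k  ≡⟨ coeff-Δ b₀ b₁ b₂ k ⟩
  _ ≡⟨ cong₂ ℚ._+_ p₅ (cong₂ ℚ._+_
         (cong₂ (λ u v → -2ℚ ℚ.* u ℚ.+ -2ℚ ℚ.* v) p₃ p₄)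
         (cong₂ (λ u v → 1ℚ ℚ.* u ℚ.+ v) p₀
           (cong₂ (λ u v → -2ℚ ℚ.* u ℚ.+ 1ℚ ℚ.* v) p₁ p₂))) ⟩
  _ ≡⟨ Δ⋆B-identity x y z ⟩
  ℚ.- (2ℚ ℚ.* (y ℚ.* y ℚ.+ ℚ.- (x ℚ.* z)))   ≡⟨ cong (λ w → ℚ.- (2ℚ ℚ.* w)) p₆ ⟨
  ℚ.- (2ℚ ℚ.* Q.shift (coeff q) k)            ≡⟨ cong ℚ.-_ (coeff-2t* q k) ⟨
  ℚ.- coeff ((1# + 1#) * t * q) k             ≡⟨ coeff-map ≡.refl ((1# + 1#) * t * q) k ⟨
  coeff (- ((1# + 1#) * t * q)) k             ∎
  where open ≡-Reasoning

-- The multipliers y and -z make the terms (1 + N) y z cancel. Naming the two left sides e₁ and e₂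
-- turns reduction modulo the relations into a plain polynomial identity.
square-relation : ∀ {K N x y z e₁ e₂} →
  K ℚ.* (x ℚ.+ y) ℚ.+ ℚ.- ((1ℚ ℚ.+ N) ℚ.* y) ≡ e₁ →
  K ℚ.* (y ℚ.+ z) ℚ.+ ℚ.- ((1ℚ ℚ.+ N) ℚ.* z ℚ.+ (y ℚ.+ z)) ≡ e₂ →
  K ℚ.* (y ℚ.* y ℚ.+ ℚ.- (x ℚ.* z)) ≡ y ℚ.* (y ℚ.+ z) ℚ.+ (y ℚ.* e₂ ℚ.+ ℚ.- (z ℚ.* e₁))
square-relation {K} {N} {x} {y} {z} ≡.refl ≡.refl = solve 5 (λ K N x y z →
  let e₁ = K :* (x :+ y) :+ :- ((con 1ℚ :+ N) :* y)
      e₂ = K :* (y :+ z) :+ :- ((con 1ℚ :+ N) :* z :+ (y :+ z))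
  in K :* (y :* y :+ :- (x :* z)) := y :* (y :+ z) :+ (y :* e₂ :+ :- (z :* e₁)))
  ≡.refl K N x y z
  where open +-*-Solver

-- The left side is free of K, and (x + y) e₂ - (y + z) e₁ is the combination of the relations from
-- which K cancels. Comparing the terms in N fixes the factor -4. Here c₀ and c₁ are the
-- contributions of the coefficients of x² and x in Δ.
ode-identity : ∀ {K N x y z e₁ e₂} → let sq = λ u → u ℚ.* u in
  K ℚ.* (x ℚ.+ y) ℚ.+ ℚ.- ((1ℚ ℚ.+ N) ℚ.* y) ≡ e₁ →
  K ℚ.* (y ℚ.+ z) ℚ.+ ℚ.- ((1ℚ ℚ.+ N) ℚ.* z ℚ.+ (y ℚ.+ z)) ≡ e₂ →
  let c₀ = 1ℚ ℚ.* sq x ℚ.+ (-2ℚ ℚ.* sq y ℚ.+ 1ℚ ℚ.* sq z)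
      c₁ = -2ℚ ℚ.* sq (x ℚ.+ y) ℚ.+ -2ℚ ℚ.* sq (y ℚ.+ z)
      s  = (2ℚ ℚ.+ N) ℚ.* sq (x ℚ.+ y ℚ.+ (y ℚ.+ z)) ℚ.+ ((1ℚ ℚ.+ N) ℚ.* c₁ ℚ.+ N ℚ.* c₀)
  in 1ℚ ℚ.* c₁ ℚ.+ 2ℚ ℚ.* c₀ ℚ.+ (s ℚ.+ s) ≡
     ℚ.- (2ℚ ℚ.* (2ℚ ℚ.* ((x ℚ.+ y) ℚ.* e₂ ℚ.+ ℚ.- ((y ℚ.+ z) ℚ.* e₁))))
ode-identity {K} {N} {x} {y} {z} ≡.refl ≡.refl = solve 5 (λ K N x y z →
  let sq = λ u → u :* u
      c₀ = con 1ℚ :* sq x :+ (con -2ℚ :* sq y :+ con 1ℚ :* sq z)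
      c₁ = con -2ℚ :* sq (x :+ y) :+ con -2ℚ :* sq (y :+ z)
      s  = (con 2ℚ :+ N) :* sq (x :+ y :+ (y :+ z)) :+ ((con 1ℚ :+ N) :* c₁ :+ N :* c₀)
      e₁ = K :* (x :+ y) :+ :- ((con 1ℚ :+ N) :* y)
      e₂ = K :* (y :+ z) :+ :- ((con 1ℚ :+ N) :* z :+ (y :+ z))
  in con 1ℚ :* c₁ :+ con 2ℚ :* c₀ :+ (s :+ s)
     := :- (con 2ℚ :* (con 2ℚ :* ((x :+ y) :* e₂ :+ :- ((y :+ z) :* e₁))))) ≡.refl K N x y z
  where open +-*-Solver

ode-coeff′ : ∀ {K x y z} N b₀ b₁ b₂ k → let sq = λ u → u ℚ.* u in
  K ℚ.* (x ℚ.+ y) ℚ.+ ℚ.- ((1ℚ ℚ.+ ι N) ℚ.* y) ≡ 0ℚ →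
  K ℚ.* (y ℚ.+ z) ℚ.+ ℚ.- ((1ℚ ℚ.+ ι N) ℚ.* z ℚ.+ (y ℚ.+ z)) ≡ 0ℚ →
  coeff b₀ k ≡ sq x → Q.shift (coeff b₀) k ≡ sq y → Q.shift (Q.shift (coeff b₀)) k ≡ sq z →
  coeff b₁ k ≡ sq (x ℚ.+ y) → Q.shift (coeff b₁) k ≡ sq (y ℚ.+ z) →
  coeff b₂ k ≡ sq (x ℚ.+ y ℚ.+ (y ℚ.+ z)) →
  let u = Δ 1 * b₁ ; v = Δ 2 * b₀ ; s = (2 ℕ.+ N) · b₂ + ((1 ℕ.+ N) · u + N · v) in
  coeff (1 · u + 2 · v + (s + s)) k ≡ 0ℚ
ode-coeff′ {K} {x} {y} {z} N b₀ b₁ b₂ k h₁ h₂ p₀ p₁ p₂ p₃ p₄ p₅ = begin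
  coeff (1 · u + 2 · v + (s + s)) k
    ≡⟨ ≡.trans (coeff-+ (1 · u + 2 · v) (s + s) k)
         (cong₂ ℚ._+_ (≡.trans (coeff-+ (1 · u) (2 · v) k)
            (cong₂ ℚ._+_ (≡.trans (coeff-· 1 u k) (cong (1ℚ ℚ.*_) u-coeff))
                         (≡.trans (coeff-· 2 v k) (cong (2ℚ ℚ.*_) v-coeff))))
          (≡.trans (coeff-+ s s k) (cong₂ ℚ._+_ s-coeff s-coeff))) ⟩
  _ ≡⟨ ode-identity {K} {ι N} {x} {y} {z} h₁ h₂ ⟩
  ℚ.- (2ℚ ℚ.* (2ℚ ℚ.* ((x ℚ.+ y) ℚ.* 0ℚ ℚ.+ ℚ.- ((y ℚ.+ z) ℚ.* 0ℚ))))
    ≡⟨ cong₂ (λ a b → ℚ.- (2ℚ ℚ.* (2ℚ ℚ.* (a ℚ.+ ℚ.- b)))) (ℚ.*-zeroʳ (x ℚ.+ y)) (ℚ.*-zeroʳ (y ℚ.+ z)) ⟩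
  0ℚ ∎
  where
  open ≡-Reasoning
  u = Δ 1 * b₁
  v = Δ 2 * b₀
  s = (2 ℕ.+ N) · b₂ + ((1 ℕ.+ N) · u + N · v)
  u-coeff = ≡.trans (coeff-linear* -2ℚ -2ℚ b₁ k) (cong₂ (λ u v → -2ℚ ℚ.* u ℚ.+ -2ℚ ℚ.* v) p₃ p₄)
  v-coeff = ≡.trans (coeff-quadratic* 1ℚ -2ℚ 1ℚ b₀ k)
    (cong₂ (λ u v → 1ℚ ℚ.* u ℚ.+ v) p₀ (cong₂ (λ u v → -2ℚ ℚ.* u ℚ.+ 1ℚ ℚ.* v) p₁ p₂))
  s-coeff = ≡.trans (coeff-+ ((2 ℕ.+ N) · b₂) _ k) (cong₂ ℚ._+_
    (≡.trans (coeff-· (2 ℕ.+ N) b₂ k) (cong₂ ℚ._*_ (ι-+ 2 N) p₅))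
    (≡.trans (coeff-+ ((1 ℕ.+ N) · u) (N · v) k) (cong₂ ℚ._+_
      (≡.trans (coeff-· (1 ℕ.+ N) u k) (cong₂ ℚ._*_ (ι-+ 1 N) u-coeff))
      (≡.trans (coeff-· N v k) (cong (ι N ℚ.*_) v-coeff)))))

module _ (N : ℕ) where
  open Coefficients N

  -- Narayana numbers are 2 by 2 minors of Pascal's triangle. At k ≥ 1 the denominator is k itself;
  -- after multiplying by it, `square-relation` with both relations 0 leaves y (y + z) = C(N, k-1)
  -- C(N+1, k-1).
  t-narayana : ∀ k → Q.shift (coeff (narayana (+ suc N))) k ≡ y k ℚ.* y k ℚ.+ ℚ.- (x k ℚ.* z k)
  t-narayana zero    = ≡.sym (begin
    0ℚ ℚ.* 0ℚ ℚ.+ ℚ.- (x 0 ℚ.* 0ℚ) ≡⟨ cong (λ u → 0ℚ ℚ.* 0ℚ ℚ.+ ℚ.- u) (ℚ.*-zeroʳ (x 0)) ⟩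
    0ℚ ∎)
    where open ≡-Reasoning
  t-narayana (suc k) = ι-suc-cancel k (begin
    ι (suc k) ℚ.* coeff (narayana (+ suc N)) k ≡⟨ coeff-narayana N k ⟩
    binom N k ℚ.* binom (suc N) k              ≡⟨ cong (binom N k ℚ.*_) (pascal N k) ⟩
    Y ℚ.* (Y ℚ.+ Z)                            ≡⟨ ℚ.+-identityʳ _ ⟨
    Y ℚ.* (Y ℚ.+ Z) ℚ.+ 0ℚ
      ≡⟨ cong (Y ℚ.* (Y ℚ.+ Z) ℚ.+_) (cong₂ (λ u v → u ℚ.+ ℚ.- v) (ℚ.*-zeroʳ Y) (ℚ.*-zeroʳ Z)) ⟨
    Y ℚ.* (Y ℚ.+ Z) ℚ.+ (Y ℚ.* 0ℚ ℚ.+ ℚ.- (Z ℚ.* 0ℚ))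
      ≡⟨ square-relation {ι (suc k)} {ι N} {x (suc k)} {Y} {Z} (e₁ (suc k)) (e₂ (suc k)) ⟨
    ι (suc k) ℚ.* (Y ℚ.* Y ℚ.+ ℚ.- (x (suc k) ℚ.* Z))  ∎)
    where
    open ≡-Reasoning
    Y = y (suc k)
    Z = z (suc k)

  Δ⋆B-coeff : Bₓ (2 ℕ.+ N) + (Δ 1 * Bₓ (suc N) + Δ 2 * Bₓ N) ≈ 1/B (2 ℕ.+ N)
  Δ⋆B-coeff = coeffwise λ k →
    Δ⋆B-coeff′ {x k} {y k} {z k} (Bₓ N) (Bₓ (suc N)) (Bₓ (2 ℕ.+ N)) (narayana (+ suc N)) k
      (B₀ k) (tB₀ k) (t²B₀ k) (B₁ k) (tB₁ k) (B₂ k) (t-narayana k)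

  ode-coeff : let u = Δ 1 * Bₓ (1 ℕ.+ N) ; v = Δ 2 * Bₓ N
                  s = (2 ℕ.+ N) · Bₓ (2 ℕ.+ N) + ((1 ℕ.+ N) · u + N · v) in
              1 · u + 2 · v + (s + s) ≈ 0#
  ode-coeff = coeffwise λ k →
    ode-coeff′ {ι k} {x k} {y k} {z k} N (Bₓ N) (Bₓ (suc N)) (Bₓ (2 ℕ.+ N)) k
      (e₁ k) (e₂ k) (B₀ k) (tB₀ k) (t²B₀ k) (B₁ k) (tB₁ k) (B₂ k)

open import Relation.Binary.Reasoning.Setoid P.setoid

-- The differential equation and the reciprocal of the generating function

Δ-⋆ : ∀ f n → (Δ ⋆ f) (2 ℕ.+ n) ≈ f (2 ℕ.+ n) + (Δ 1 * f (1 ℕ.+ n) + Δ 2 * f n)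
Δ-⋆ f n = P.+-cong (P.*-identityˡ (f (2 ℕ.+ n)))
  (P.+-congˡ (⋆-constˡ (λ _ → P.refl) f n))

n·0≈0 : ∀ n → n · 0# ≈ 0#
n·0≈0 zero    = P.refl
n·0≈0 (suc n) = P.trans (P.+-identityˡ (n · 0#)) (n·0≈0 n)

θΔ-⋆ : ∀ f n → (θ Δ ⋆ f) (2 ℕ.+ n) ≈ 1 · (Δ 1 * f (1 ℕ.+ n)) + 2 · (Δ 2 * f n)
θΔ-⋆ f n = begin
  (θ Δ ⋆ f) (2 ℕ.+ n)  ≈⟨ P.+-identityˡ _ ⟩
  θ Δ 1 * f (1 ℕ.+ n) + ((λ k → θ Δ (2 ℕ.+ k)) ⋆ f) n
    ≈⟨ P.+-cong (×-assoc-* 1 (Δ 1) (f (1 ℕ.+ n)))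
         (P.trans (⋆-constˡ (λ k → n·0≈0 (3 ℕ.+ k)) f n) (×-assoc-* 2 (Δ 2) (f n))) ⟩
  1 · (Δ 1 * f (1 ℕ.+ n)) + 2 · (Δ 2 * f n)  ∎

Δ-⋆-θ : ∀ f n → (Δ ⋆ θ f) (2 ℕ.+ n) ≈
  (2 ℕ.+ n) · f (2 ℕ.+ n) + ((1 ℕ.+ n) · (Δ 1 * f (1 ℕ.+ n)) + n · (Δ 2 * f n))
Δ-⋆-θ f n = P.trans (Δ-⋆ (θ f) n) (P.+-congˡ {θ f (2 ℕ.+ n)} (P.+-cong
  (×-comm-* (1 ℕ.+ n) (Δ 1) (f (1 ℕ.+ n))) (×-comm-* n (Δ 2) (f n))))

Δ-ode : θ Δ ⋆ Bₓ ⊕ (Δ ⋆ θ Bₓ ⊕ Δ ⋆ θ Bₓ) ≋ 𝟘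
-- Degrees 0 and 1 precede the three-term recurrence and are computed outright.
Δ-ode 0 = coeffwise λ { 0 → ≡.refl ; (suc k) → ≡.refl }
Δ-ode 1 = coeffwise λ { 0 → ≡.refl ; 1 → ≡.refl ; (suc (suc k)) → ≡.refl }
Δ-ode (suc (suc n)) = begin
  (θ Δ ⋆ Bₓ) (2 ℕ.+ n) + ((Δ ⋆ θ Bₓ) (2 ℕ.+ n) + (Δ ⋆ θ Bₓ) (2 ℕ.+ n))
    ≈⟨ P.+-cong (θΔ-⋆ Bₓ n) (P.+-cong (Δ-⋆-θ Bₓ n) (Δ-⋆-θ Bₓ n)) ⟩
  _ ≈⟨ ode-coeff n ⟩
  0# ∎

Δ⋆B : Δ ⋆ Bₓ ≋ 1/B
Δ⋆B 0 = coeffwise λ { 0 → ≡.refl ; (suc k) → ≡.refl }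
Δ⋆B 1 = coeffwise λ { 0 → ≡.refl ; 1 → ≡.refl ; (suc (suc k)) → ≡.refl }
Δ⋆B (suc (suc n)) = P.trans (Δ-⋆ Bₓ n) (Δ⋆B-coeff n)

1/B⋆B : 1/B ⋆ Bₓ ≋ 𝟙
1/B⋆B n = P.trans (⋆-cong {g = Bₓ} (λ k → P.sym (Δ⋆B k)) (λ _ → P.refl) n)
  (inverse-square-root ·-torsion-free {Δ} {Bₓ}
    (coeffwise λ { 0 → ≡.refl ; (suc k) → ≡.refl }) Δ-ode n)

-- Hankel determinants of B with negative shift

B-⊖ : ∀ s m → B (s ℤ.⊖ m) ≡ (x^ m · Bₓ) s
B-⊖ s       zero    = ≡.refl
-- The extension of `B` by 0 to negative indices matches the zeros of xᵐ b below degree m.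
B-⊖ zero    (suc m) = ≡.refl
B-⊖ (suc s) (suc m) = ≡.trans (cong B (ℤ.[1+m]⊖[1+n]≡m⊖n s m)) (B-⊖ s m)

D-B : ∀ m n → D B (ℤ.- (+ m)) n ≈ Det (λ (i j : Fin n) → (x^ m · Bₓ) (toℕ i ℕ.+ toℕ j))
D-B m n = P.trans (P.reflexive (≡.sym (Det≡det {n} _)))
  (det-cong λ i j → P.reflexive (≡.trans
    (cong B (ℤ.m-n≡m⊖n (toℕ i ℕ.+ toℕ j) m)) (B-⊖ (toℕ i ℕ.+ toℕ j) m)))

-- Writing the size as m + 1 + N avoids truncated subtraction. N is the size of the remaining block,
-- hence also the exponent of 2 t, one factor for each row.
D-B-shifted : ∀ m N → D B (ℤ.- (+ m)) (suc m ℕ.+ N) ≈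
  (- 1#) ^ (suc m C 2) * ((1# + 1#) * t) ^ N * p (suc m) N
D-B-shifted m N = begin
  D B (ℤ.- (+ m)) (suc m ℕ.+ N)  ≈⟨ D-B m (suc m ℕ.+ N) ⟩
  Det (λ (i j : Fin (suc m ℕ.+ N)) → (x^ m · Bₓ) (toℕ i ℕ.+ toℕ j))
    ≈⟨ hankel-inverse m P.refl (coeffwise λ { 0 → ≡.refl ; (suc k) → ≡.refl }) 1/B⋆B ⟩
  (- 1#) ^ (suc m C 2) * Det (λ (i j : Fin N) → - 1/B (toℕ i ℕ.+ toℕ j ℕ.+ suc (suc m)))
    ≈⟨ P.*-congˡ {(- 1#) ^ (suc m C 2)} (det-cong λ i j → entry (toℕ i ℕ.+ toℕ j)) ⟩
  (- 1#) ^ (suc m C 2) * Det (λ (i j : Fin N) → (1# + 1#) * t * c i j)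
    ≈⟨ P.*-congˡ {(- 1#) ^ (suc m C 2)} (det-scale ((1# + 1#) * t) c) ⟩
  (- 1#) ^ (suc m C 2) * (((1# + 1#) * t) ^ N * Det c)
    ≈⟨ P.*-assoc ((- 1#) ^ (suc m C 2)) (((1# + 1#) * t) ^ N) (Det c) ⟨
  (- 1#) ^ (suc m C 2) * ((1# + 1#) * t) ^ N * Det c
    ≡⟨ cong ((- 1#) ^ (suc m C 2) * ((1# + 1#) * t) ^ N *_) (Det≡det c) ⟩
  (- 1#) ^ (suc m C 2) * ((1# + 1#) * t) ^ N * p (suc m) N  ∎
  where
  c : Matrix N N
  c i j = narayana (+ (toℕ i ℕ.+ toℕ j ℕ.+ suc m))
  entry : ∀ s → - 1/B (s ℕ.+ suc (suc m)) ≈ (1# + 1#) * t * narayana (+ (s ℕ.+ suc m))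
  entry s = begin
    - 1/B (s ℕ.+ suc (suc m))
      -- The index is at least m + 2, so only the third clause of `1/B` occurs. It lowers the index
      -- by one, whence the shift m + 1 of the Narayana determinant.
      ≡⟨ cong (λ k → - 1/B k) (≡.trans (ℕ.+-suc s (suc m)) (cong suc (ℕ.+-suc s m))) ⟩
    - 1/B (suc (suc (s ℕ.+ m)))  ≈⟨ -‿involutive ((1# + 1#) * t * narayana (+ suc (s ℕ.+ m))) ⟩
    (1# + 1#) * t * narayana (+ suc (s ℕ.+ m))
      ≡⟨ cong (λ k → (1# + 1#) * t * narayana (+ k)) (ℕ.+-suc s m) ⟨
    (1# + 1#) * t * narayana (+ (s ℕ.+ suc m))  ∎

theorem9 : ∀ (m : ℕ) → 1 ≤ m →
    (∀ (n : ℕ) → 1 ≤ n → n ≤ m → D B (ℤ.- (+ m)) n ≈ 0#)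
    × (∀ (n : ℕ) → m ℕ.+ 1 ≤ n →
    D B (ℤ.- (+ m)) n
    ≈ (- 1#) ^ ((m ℕ.+ 1) C 2)
    * ((1# + 1#) * t) ^ (n ∸ m ∸ 1)
    * p (m ℕ.+ 1) (n ∸ m ∸ 1))
theorem9 m _ = vanishing , reduction
  where
  vanishing : ∀ (n : ℕ) → 1 ≤ n → n ≤ m → D B (ℤ.- (+ m)) n ≈ 0#
  -- Row 0 lists the first suc n ≤ m coefficients of xᵐ b, all of them 0.
  vanishing (suc n) _ n<m = P.trans (D-B m (suc n)) (det-zero-row _ λ j →
    P.reflexive (x^-low Bₓ (ℕ.<-≤-trans (toℕ<n j) n<m)))

  reduction : ∀ (n : ℕ) → m ℕ.+ 1 ≤ n → D B (ℤ.- (+ m)) n ≈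
    (- 1#) ^ ((m ℕ.+ 1) C 2) * ((1# + 1#) * t) ^ (n ∸ m ∸ 1) * p (m ℕ.+ 1) (n ∸ m ∸ 1)
  -- Both truncated subtractions merge into n ∸ suc m, which is exact because suc m ≤ n.
  reduction n m<n rewrite ℕ.∸-+-assoc n m 1 | ℕ.+-comm m 1 =
    ≡.subst (λ l → D B (ℤ.- (+ m)) l ≈
      (- 1#) ^ (suc m C 2) * ((1# + 1#) * t) ^ (n ∸ suc m) * p (suc m) (n ∸ suc m))
      (ℕ.m+[n∸m]≡n m<n) (D-B-shifted m (n ∸ suc m))
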